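{- Let $d,\ell,m$ be integers with $d\geq 1$ odd, $\ell\geq 0$ and $m\geq 3$. Suppose that either $d\equiv (-1)^\ell \pmod 6$, or $m$ is even and $d\equiv 3\pmod 6$, or $m$ is odd and $d\equiv 9 \pmod{18}$. Then there exists an abelian group $G$ of order $2^{\ell+m}d$ such that (1) $G$ has exactly $f=2^m-1$ involutions (elements of order $2$), and (2) there exists a $(G,\{2^f,3^e\},3,1)$-difference family for some $e\in\{0,1,2\}$.
   Context: Let $(G,+)$ be a finite abelian group. A partial spread of $G$ is a family $\Sigma$ of subgroups of $G$ whose members pairwise intersect trivially; it has type $\{n_1^{f_1},\dots,n_t^{f_t}\}$ if it consists of exactly $f_i$ subgroups of order $n_i$ for each $i$ (and no others). For a triple $T=\{a,b,c\}$ of three distinct elements of $G$, its list of differences is the multiset $\Delta T=\{\pm(a-b),\pm(a-c),\pm(b-c)\}$, and for a set $\mathcal T$ of triples, $\Delta\mathcal T$ is the multiset union of the $\Delta T$, $T\in\mathcal T$. For a partial spread $\Sigma$, a $(G,\Sigma,3,1)$-difference family is a set $\mathcal T$ of triples of $G$ such that $\Delta\mathcal T=G\setminus\bigcup_{S\in\Sigma}S$ as multisets (every element outside $\bigcup_{S\in\Sigma}S$ occurs exactly once in $\Delta\mathcal T$, and no element of $\bigcup_{S\in\Sigma}S$ occurs). A $(G,\tau,3,1)$-difference family, for a type $\tau$, is a $(G,\Sigma,3,1)$-difference family for some partial spread $\Sigma$ of $G$ of type $\tau$. -}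

module Defs where

open import Data.Nat using (ℕ; zero; suc; _+_; _*_; _∸_; _^_; _≤_; _%_)
open import Data.Nat.DivMod using (m%n<n)
open import Data.Fin using (Fin; toℕ; fromℕ<)
import Data.Fin.Properties as FinP
import Data.Fin as Fin
open import Data.Unit using (⊤; tt)
open import Data.Product using (Σ; _×_; _,_; ∃; ∃-syntax)
open import Data.Sum using (_⊎_)
open import Data.List using (List; []; _∷_; length; filter; map; concatMap; _++_)
open import Data.Nat.ListAction using (product)
open import Data.List.Membership.Propositional using (_∈_; _∉_)
open import Data.List.Relation.Unary.All using (All)
open import Data.List.Relation.Unary.Any using (Any)
open import Data.List.Relation.Unary.AllPairs using (AllPairs)
open import Data.List.Relation.Unary.Unique.Propositional using (Unique)
open import Relation.Binary.PropositionalEquality using (_≡_; _≢_; refl; cong₂)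
open import Relation.Nullary using (Dec; yes; no; ¬_)
open import Function using (_⇔_)

-- Finite abelian groups, concretely: G = ℤ_{k₁+1} × … × ℤ_{kₜ+1}
-- (every finite abelian group is isomorphic to one of these).
-- A group is described by the list ks = [k₁, …, kₜ]; the i-th
-- cyclic factor has order suc kᵢ (so every factor is non-trivial
-- as a modulus ≥ 1).

Elt : List ℕ → Set
Elt []       = ⊤
Elt (k ∷ ks) = Fin (suc k) × Elt ks

order : List ℕ → ℕ
order ks = product (map suc ks)

_+ₘ_ : ∀ {k} → Fin (suc k) → Fin (suc k) → Fin (suc k)
_+ₘ_ {k} a b = fromℕ< (m%n<n (toℕ a + toℕ b) (suc k))

-ₘ_ : ∀ {k} → Fin (suc k) → Fin (suc k)
-ₘ_ {k} a = fromℕ< (m%n<n (suc k ∸ toℕ a) (suc k))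

0G : ∀ ks → Elt ks
0G []       = tt
0G (k ∷ ks) = Fin.zero , 0G ks

_⊕_ : ∀ {ks} → Elt ks → Elt ks → Elt ks
_⊕_ {[]}     _        _        = tt
_⊕_ {k ∷ ks} (a , x) (b , y) = (a +ₘ b) , (x ⊕ y)

⊖_ : ∀ {ks} → Elt ks → Elt ks
⊖_ {[]}     _       = tt
⊖_ {k ∷ ks} (a , x) = (-ₘ a) , (⊖ x)

_⊝_ : ∀ {ks} → Elt ks → Elt ks → Elt ks
x ⊝ y = x ⊕ (⊖ y)

_≟G_ : ∀ {ks} → (x y : Elt ks) → Dec (x ≡ y)
_≟G_ {[]}     tt tt = yes refl
_≟G_ {k ∷ ks} (a , x) (b , y) with a FinP.≟ b | x ≟G y
... | yes refl | yes refl = yes refl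
... | no a≢b   | _        = no λ { refl → a≢b refl }
... | yes _    | no x≢y   = no λ { refl → x≢y refl }

occ : ∀ {ks} → Elt ks → List (Elt ks) → ℕ
occ x xs = length (filter (x ≟G_) xs)

IsInvolution : ∀ {ks} → Elt ks → Set
IsInvolution {ks} x = (x ≢ 0G ks) × (x ⊕ x ≡ 0G ks)

HasExactlyInvolutions : List ℕ → ℕ → Set
HasExactlyInvolutions ks f =
  Σ (List (Elt ks)) λ L →
    Unique L × length L ≡ f × (∀ x → (x ∈ L ⇔ IsInvolution x))

-- Subgroups, represented by a duplicate-free list of their elements;
-- the order of the subgroup is the length of the list.

IsSubgroup : ∀ ks → List (Elt ks) → Set
IsSubgroup ks S =
  Unique S × (0G ks ∈ S)
  × (∀ {x y} → x ∈ S → y ∈ S → (x ⊕ y) ∈ S)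
  × (∀ {x} → x ∈ S → (⊖ x) ∈ S)

TrivInter : ∀ {ks} → List (Elt ks) → List (Elt ks) → Set
TrivInter {ks} S T = ∀ {x} → x ∈ S → x ∈ T → x ≡ 0G ks

-- Σ is a partial spread (members listed without repetition; two
-- distinct positions give trivially intersecting subgroups, hence
-- for non-trivial members also distinct subgroups)
IsPartialSpread : ∀ ks → List (List (Elt ks)) → Set
IsPartialSpread ks Sg = All (IsSubgroup ks) Sg × AllPairs TrivInter Sg

IsPartialSpreadType23 : ∀ ks → ℕ → ℕ → List (List (Elt ks)) → List (List (Elt ks)) → Set
IsPartialSpreadType23 ks f e Σ₂ Σ₃ =
  IsPartialSpread ks (Σ₂ ++ Σ₃)
  × All (λ S → length S ≡ 2) Σ₂ × length Σ₂ ≡ f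
  × All (λ S → length S ≡ 3) Σ₃ × length Σ₃ ≡ e

Triple : List ℕ → Set
Triple ks = Elt ks × Elt ks × Elt ks

DistinctTriple : ∀ {ks} → Triple ks → Set
DistinctTriple (a , b , c) = (a ≢ b) × (a ≢ c) × (b ≢ c)

ΔT : ∀ {ks} → Triple ks → List (Elt ks)
ΔT (a , b , c) =
  (a ⊝ b) ∷ (b ⊝ a) ∷ (a ⊝ c) ∷ (c ⊝ a) ∷ (b ⊝ c) ∷ (c ⊝ b) ∷ []

Δ : ∀ {ks} → List (Triple ks) → List (Elt ks)
Δ 𝒯 = concatMap ΔT 𝒯

InUnion : ∀ {ks} → Elt ks → List (List (Elt ks)) → Set
InUnion x Sg = Any (x ∈_) Sg

IsDifferenceFamily : ∀ ks → List (List (Elt ks)) → List (Triple ks) → Set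
IsDifferenceFamily ks Sg 𝒯 =
  All DistinctTriple 𝒯
  × (∀ x → (InUnion x Sg → occ x (Δ 𝒯) ≡ 0)
         × (¬ InUnion x Sg → occ x (Δ 𝒯) ≡ 1))

HasDF23 : ∀ ks → ℕ → ℕ → Set
HasDF23 ks f e =
  Σ (List (List (Elt ks))) λ Σ₂ → Σ (List (List (Elt ks))) λ Σ₃ →
  Σ (List (Triple ks)) λ 𝒯 →
    IsPartialSpreadType23 ks f e Σ₂ Σ₃ × IsDifferenceFamily ks (Σ₂ ++ Σ₃) 𝒯

Hyp31 : ℕ → ℕ → ℕ → Set
Hyp31 d ℓ m =
  (ℓ % 2 ≡ 0 × d % 6 ≡ 1)
  ⊎ (ℓ % 2 ≡ 1 × d % 6 ≡ 5)
  ⊎ (m % 2 ≡ 0 × d % 6 ≡ 3)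
  ⊎ (m % 2 ≡ 1 × d % 18 ≡ 9)

{-# OPTIONS --safe #-}
module Submission where

-- A triple {0 , x , x + y} has the differences ± x, ± y, ± (x + y), so a difference family is a list of
-- pairs (x , y).  By pigeonhole it is enough that zero, the involutions, the elements of the chosen
-- subgroups of order 3 and all these differences cover G and are |G| in number.
--
-- A solution over G gives one over ℤ₂² × G, because w ↦ φ w and w ↦ w + φ w can both be bijections of
-- ℤ₂² (and the three nonzero w form a zero-sum triple that takes care of the order 3 elements).  So
-- m = 3 and m = 4 suffice.  There G = ℤ_{2N} × V with V = ℤ₂², ℤ₂³ or ℤ₂² × ℤ₃, and up to sign the
-- first coordinate is a height h ≤ N.
--
-- Every height is given one of three colours, that is, one of three functionals V → ℤ₂ which halves its
-- copy of V.  If i + l = h for three heights of different colours, any choice of one half at each of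
-- them is used up by pairs (i , p), (l , q) with sum (h , p + q).  A zigzag through an interval of
-- consecutive heights has the differences 1, 2, 3, …; two zigzags through adjacent intervals of m heights
-- use each difference i < m twice, once per half, and each height of the intervals twice except at the
-- four ends.  If d ≡ ± 1 (mod 6), two further edges of difference m join the ends.  If 3 ∣ d, the ends
-- together with the order 3 elements are settled by small tables found by computer search.

open import Defs
open import Algebra.Bundles using (AbelianGroup)
import Algebra.Properties.AbelianGroup as AbelianGroupProperties
open import Data.Bool using (Bool; true; false; not; _xor_)
import Data.Bool.Properties as Bool
open import Data.Fin using (Fin; toℕ; fromℕ<)
import Data.Fin as Fin
open import Data.Fin.Patterns
open import Data.Fin.Properties as FinP using (toℕ-fromℕ<; fromℕ<-cong; toℕ<n; toℕ-injective)
open import Data.List using (List; []; _∷_; length; map; concatMap; _++_; allFin; cartesianProduct; cartesianProductWith; drop)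
open import Data.List.Membership.Propositional using (_∈_; _∉_; find; lose)
open import Data.List.Membership.Propositional.Properties using (∈-∃++; ∈-allFin; ∈-cartesianProduct⁺; ∈-++⁺ˡ; ∈-++⁺ʳ; ∈-++⁻; ∈-map⁺; ∈-map⁻)
import Data.List.Membership.DecPropositional as DecMembership
open import Data.List.Properties using (length-++; length-map; length-tabulate; filter-none; length-++-sucʳ)
open import Data.List.Relation.Binary.Disjoint.Propositional using (Disjoint)
open import Data.List.Relation.Binary.Permutation.Propositional as Perm using (_↭_; ↭-refl; ↭-sym; ↭-trans; prep)
open import Data.List.Relation.Binary.Permutation.Propositional.Properties using (shift; All-resp-↭)
open import Data.List.Relation.Unary.All as All using (All; []; _∷_)
import Data.List.Relation.Unary.All.Properties as AllP
open import Data.List.Relation.Unary.AllPairs as AllPairs using (AllPairs; []; _∷_)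
import Data.List.Relation.Unary.AllPairs.Properties as AllPairsP
open import Data.List.Relation.Unary.Any as Any using (Any; here; there)
import Data.List.Relation.Unary.Any.Properties as AnyP
open import Data.List.Relation.Unary.Unique.Propositional using (Unique)
import Data.List.Relation.Unary.Unique.Propositional.Properties as UniqueP
open import Data.Nat using (ℕ; zero; suc; _+_; _*_; _∸_; _^_; _≤_; _<_; _%_; _/_; z≤n; s≤s; s≤s⁻¹; NonZero)
open import Data.Nat.DivMod using (m%n<n; %-distribˡ-+; n%n≡0; m<n⇒m%n≡m; m≡m%n+[m/n]*n; [m+kn]%n≡m%n)
open import Data.Nat.ListAction using () renaming (sum to total)
open import Data.Nat.Properties
open import Data.Nat.Tactic.RingSolver using (solve-∀)
open import Data.Product using (Σ; _×_; _,_; proj₁; proj₂; ∃)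
open import Data.Sum as Sum using (_⊎_; inj₁; inj₂; map₂)
open import Data.Unit using (tt)
open import Function using (_∘_; id; mk⇔)
open import Level using (0ℓ)
open import Relation.Binary.Definitions using (tri<; tri≈; tri>)
open import Relation.Binary.PropositionalEquality
open import Relation.Nullary using (Dec; ¬_; yes; no; contradiction)
open import Relation.Nullary.Decidable using (toWitness; map′; _×-dec_; _⊎-dec_; _→-dec_)

-- Residues modulo `suc k` and the abelian group structure.

module _ {k : ℕ} where

  ι : ℕ → Fin (suc k)
  ι n = fromℕ< (m%n<n n (suc k))

  toℕ-ι : ∀ n → toℕ (ι n) ≡ n % suc k
  toℕ-ι n = toℕ-fromℕ< _

  ι-cong : ∀ m n → m % suc k ≡ n % suc k → ι m ≡ ι n
  ι-cong m n eq = fromℕ<-cong _ _ eq _ _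

  ι-toℕ : ∀ a → ι (toℕ a) ≡ a
  ι-toℕ a = toℕ-injective (trans (toℕ-ι (toℕ a)) (m<n⇒m%n≡m (toℕ<n a)))

  ι-+ : ∀ m n → ι (m + n) ≡ ι m +ₘ ι n
  ι-+ m n = ι-cong (m + n) (toℕ (ι m) + toℕ (ι n)) (trans (%-distribˡ-+ m n (suc k)) (cong₂ (λ x y → (x + y) % suc k) (sym (toℕ-ι m)) (sym (toℕ-ι n))))

  ι-modulus : ι (suc k) ≡ Fin.zero
  ι-modulus = toℕ-injective (trans (toℕ-ι (suc k)) (n%n≡0 (suc k)))

  +ₘ-comm : ∀ (a b : Fin (suc k)) → a +ₘ b ≡ b +ₘ a
  +ₘ-comm a b = cong ι (+-comm (toℕ a) (toℕ b))

  +ₘ-assoc : ∀ (a b c : Fin (suc k)) → (a +ₘ b) +ₘ c ≡ a +ₘ (b +ₘ c)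
  +ₘ-assoc a b c = begin
    ι (toℕ a + toℕ b) +ₘ c                 ≡⟨ cong (ι (toℕ a + toℕ b) +ₘ_) (ι-toℕ c) ⟨
    ι (toℕ a + toℕ b) +ₘ ι (toℕ c)         ≡⟨ ι-+ (toℕ a + toℕ b) (toℕ c) ⟨
    ι (toℕ a + toℕ b + toℕ c)              ≡⟨ cong ι (+-assoc (toℕ a) (toℕ b) (toℕ c)) ⟩
    ι (toℕ a + (toℕ b + toℕ c))            ≡⟨ ι-+ (toℕ a) (toℕ b + toℕ c) ⟩
    ι (toℕ a) +ₘ ι (toℕ b + toℕ c)         ≡⟨ cong (_+ₘ (b +ₘ c)) (ι-toℕ a) ⟩
    a +ₘ (b +ₘ c)                          ∎ where open ≡-Reasoning

  +ₘ-identityˡ : ∀ (a : Fin (suc k)) → Fin.zero +ₘ a ≡ a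
  +ₘ-identityˡ = ι-toℕ

  +ₘ-inverseʳ : ∀ (a : Fin (suc k)) → a +ₘ (-ₘ a) ≡ Fin.zero
  +ₘ-inverseʳ a = begin
    a +ₘ ι (suc k ∸ toℕ a)               ≡⟨ cong (_+ₘ ι (suc k ∸ toℕ a)) (ι-toℕ a) ⟨
    ι (toℕ a) +ₘ ι (suc k ∸ toℕ a)       ≡⟨ ι-+ (toℕ a) _ ⟨
    ι (toℕ a + (suc k ∸ toℕ a))          ≡⟨ cong ι (m+[n∸m]≡n (<⇒≤ (toℕ<n a))) ⟩
    ι (suc k)                            ≡⟨ ι-modulus ⟩
    Fin.zero                             ∎ where open ≡-Reasoning

⊕-comm : ∀ {ks} (x y : Elt ks) → x ⊕ y ≡ y ⊕ x
⊕-comm {[]}     _       _       = refl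
⊕-comm {_ ∷ _} (a , x) (b , y) = cong₂ _,_ (+ₘ-comm a b) (⊕-comm x y)

⊕-assoc : ∀ {ks} (x y z : Elt ks) → (x ⊕ y) ⊕ z ≡ x ⊕ (y ⊕ z)
⊕-assoc {[]}     _       _       _       = refl
⊕-assoc {_ ∷ _} (a , x) (b , y) (c , z) = cong₂ _,_ (+ₘ-assoc a b c) (⊕-assoc x y z)

⊕-identityˡ : ∀ {ks} (x : Elt ks) → 0G ks ⊕ x ≡ x
⊕-identityˡ {[]}     _       = refl
⊕-identityˡ {_ ∷ _} (a , x) = cong₂ _,_ (+ₘ-identityˡ a) (⊕-identityˡ x)

⊕-inverseʳ : ∀ {ks} (x : Elt ks) → x ⊕ (⊖ x) ≡ 0G ks
⊕-inverseʳ {[]}     _       = refl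
⊕-inverseʳ {_ ∷ _} (a , x) = cong₂ _,_ (+ₘ-inverseʳ a) (⊕-inverseʳ x)

⊕-identityʳ : ∀ {ks} (x : Elt ks) → x ⊕ 0G ks ≡ x
⊕-identityʳ x = trans (⊕-comm x _) (⊕-identityˡ x)

⊕-inverseˡ : ∀ {ks} (x : Elt ks) → (⊖ x) ⊕ x ≡ 0G ks
⊕-inverseˡ x = trans (⊕-comm _ x) (⊕-inverseʳ x)

⊕-abelianGroup : List ℕ → AbelianGroup 0ℓ 0ℓ
⊕-abelianGroup ks = record
  { Carrier = Elt ks ; _≈_ = _≡_ ; _∙_ = _⊕_ ; ε = 0G ks ; _⁻¹ = ⊖_
  ; isAbelianGroup = record
    { isGroup = record
      { isMonoid = record
        { isSemigroup = record
          { isMagma = record { isEquivalence = isEquivalence ; ∙-cong = cong₂ _⊕_ }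
          ; assoc = ⊕-assoc }
        ; identity = ⊕-identityˡ , ⊕-identityʳ }
      ; inverse = ⊕-inverseˡ , ⊕-inverseʳ
      ; ⁻¹-cong = cong ⊖_ }
    ; comm = ⊕-comm } }

module _ {ks : List ℕ} where
  open AbelianGroupProperties (⊕-abelianGroup ks) public
    using (xyx⁻¹≈y)
    renaming (⁻¹-involutive to ⊖-involutive; ε⁻¹≈ε to ⊖-0G; ⁻¹-∙-comm to ⊖-⊕-comm
             ; inverseˡ-unique to ⊕-inverseˡ-unique; inverseʳ-unique to ⊕-inverseʳ-unique)

-- Three heights that add up to the modulus give a zero-sum triple too; the `minus` rows of the
-- tables rest on this.
ι-opposite : ∀ {k} a b c → a + b + c ≡ suc k → ι {k} a +ₘ ι b ≡ -ₘ ι c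
ι-opposite {k} a b c eq = cong proj₁ (⊕-inverseˡ-unique {k ∷ []} (ι a +ₘ ι b , tt) (ι c , tt) (cong (_, tt) (begin
  (ι a +ₘ ι b) +ₘ ι c  ≡⟨ cong (_+ₘ ι c) (ι-+ a b) ⟨
  ι (a + b) +ₘ ι c     ≡⟨ ι-+ (a + b) c ⟨
  ι (a + b + c)        ≡⟨ cong ι eq ⟩
  ι (suc k)            ≡⟨ ι-modulus ⟩
  Fin.zero             ∎))) where open ≡-Reasoning

-- Pigeonhole: a covering of the right length has no repetition.

covering⇒↭ : ∀ {A : Set} {xs ys : List A} → Unique xs → (∀ {x} → x ∈ xs → x ∈ ys) →
             length ys ≤ length xs → xs ↭ ys
covering⇒↭ {xs = []}     {[]} _ _ _ = ↭-refl
-- One occurrence of `x` is cut out of `ys`. The other entries of `xs` differ from `x`, so they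
-- survive the cut.
covering⇒↭ {xs = x ∷ xs} (x∉xs ∷ xs!) xs⊆ys len with ∈-∃++ (xs⊆ys (here refl))
... | as , bs , refl = ↭-trans (prep x (covering⇒↭ xs! xs⊆ len′)) (↭-sym (shift x as bs))
  where
  xs⊆ : ∀ {y} → y ∈ xs → y ∈ as ++ bs
  xs⊆ y∈xs with ∈-++⁻ as (xs⊆ys (there y∈xs))
  ... | inj₁ y∈as           = ∈-++⁺ˡ y∈as
  ... | inj₂ (here refl)    = contradiction refl (All.lookup x∉xs y∈xs)
  ... | inj₂ (there y∈bs)   = ∈-++⁺ʳ as y∈bs
  len′ : length (as ++ bs) ≤ length xs
  len′ = s≤s⁻¹ (subst (_≤ suc (length xs)) (length-++-sucʳ as x bs) len)

Unique-resp-↭ : ∀ {A : Set} {xs ys : List A} → xs ↭ ys → Unique xs → Unique ys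
Unique-resp-↭ Perm.refl         u = u
Unique-resp-↭ (Perm.prep x p)   (x∉ ∷ u) = All-resp-↭ p x∉ ∷ Unique-resp-↭ p u
Unique-resp-↭ (Perm.swap x y p) ((x≢y ∷ x∉) ∷ y∉ ∷ u) =
  ((x≢y ∘ sym) ∷ All-resp-↭ p y∉) ∷ All-resp-↭ p x∉ ∷ Unique-resp-↭ p u
Unique-resp-↭ (Perm.trans p q)  u = Unique-resp-↭ q (Unique-resp-↭ p u)

Unique-++⁻ : ∀ {A : Set} (xs {ys} : List A) → Unique (xs ++ ys) →
             Unique xs × Unique ys × Disjoint xs ys
Unique-++⁻ []       u        = [] , u , λ ()
Unique-++⁻ (x ∷ xs) (x∉ ∷ u) with Unique-++⁻ xs u
... | u₁ , u₂ , disj = (AllP.++⁻ˡ xs x∉ ∷ u₁) , u₂ , λ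
  { (here refl , y∈) → All.lookup (AllP.++⁻ʳ xs x∉) y∈ refl
  ; (there x∈  , y∈) → disj (x∈ , y∈) }

elements : ∀ ks → List (Elt ks)
elements []       = tt ∷ []
elements (k ∷ ks) = cartesianProduct (allFin (suc k)) (elements ks)

∈-elements : ∀ {ks} (x : Elt ks) → x ∈ elements ks
∈-elements {[]}    tt      = here refl
∈-elements {_ ∷ _} (a , x) = ∈-cartesianProduct⁺ (∈-allFin a) (∈-elements x)

elements-unique : ∀ ks → Unique (elements ks)
elements-unique []       = [] ∷ []
elements-unique (k ∷ ks) = UniqueP.cartesianProduct⁺ (UniqueP.allFin⁺ (suc k)) (elements-unique ks)

length-cartesianProduct : ∀ {A B : Set} (xs : List A) (ys : List B) →
                          length (cartesianProduct xs ys) ≡ length xs * length ys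
length-cartesianProduct []       ys = refl
length-cartesianProduct (x ∷ xs) ys = trans (length-++ (map (x ,_) ys))
  (cong₂ _+_ (length-map (x ,_) ys) (length-cartesianProduct xs ys))

length-elements : ∀ ks → length (elements ks) ≡ order ks
length-elements []       = refl
length-elements (k ∷ ks) = trans (length-cartesianProduct (allFin (suc k)) (elements ks))
  (cong₂ _*_ (length-tabulate {n = suc k} id) (length-elements ks))

-- `elements ks` is contained in `xs` and equally long, so `xs` is a rearrangement of it.
-- Distinctness of the differences thus never has to be checked directly.
covering⇒Unique : ∀ {ks} {xs : List (Elt ks)} → (∀ x → x ∈ xs) → length xs ≡ order ks → Unique xs
covering⇒Unique {ks} cov len = Unique-resp-↭
  (covering⇒↭ (elements-unique ks) (λ _ → cov _) (≤-reflexive (trans len (sym (length-elements ks)))))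
  (elements-unique ks)

occ-∉ : ∀ {ks} {x : Elt ks} {xs} → x ∉ xs → occ x xs ≡ 0
occ-∉ {x = x} x∉xs = cong length (filter-none (x ≟G_) (AllP.¬Any⇒All¬ _ x∉xs))

occ-∈-Unique : ∀ {ks} {x : Elt ks} {xs} → Unique xs → x ∈ xs → occ x xs ≡ 1
occ-∈-Unique {x = x} {y ∷ xs} (y∉ ∷ u) x∈ with x ≟G y
... | yes refl = cong suc (occ-∉ (λ x∈xs → All.lookup y∉ x∈xs refl))
occ-∈-Unique {x = x} {y ∷ xs} (y∉ ∷ u) (here x≡y)   | no x≢y = contradiction x≡y x≢y
occ-∈-Unique {x = x} {y ∷ xs} (y∉ ∷ u) (there x∈xs) | no x≢y = occ-∈-Unique u x∈xs

-- Systems of pairs, and the difference families they give.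

Pair : List ℕ → Set
Pair ks = Elt ks × Elt ks

data Meets {ks} : Pair ks → Elt ks → Set where
  fst : ∀ {x y}   → Meets (x , y) x
  snd : ∀ {x y}   → Meets (x , y) y
  sum : ∀ {x y z} → x ⊕ y ≡ z → Meets (x , y) z

-- Nothing here asks for distinctness or disjointness: `covered` and `counted` together force both.
-- A subgroup of order 3 is represented in `thirds` by one of its two generators.
record System (ks : List ℕ) (m e : ℕ) : Set where
  field
    involutions : List (Elt ks)
    thirds      : List (Elt ks)
    pairs       : List (Pair ks)
    double≡0    : All (λ x → x ⊕ x ≡ 0G ks) involutions
    double≡neg  : All (λ s → s ⊕ s ≡ ⊖ s) thirds
    #involutions : suc (length involutions) ≡ 2 ^ m
    #thirds      : length thirds ≡ e
    covered     : ∀ g → g ∈ 0G ks ∷ involutions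
                      ⊎ Any (λ s → g ≡ s ⊎ ⊖ g ≡ s) thirds
                      ⊎ Any (λ p → Meets p g ⊎ Meets p (⊖ g)) pairs
    counted     : suc (length involutions) + 2 * length thirds + 6 * length pairs ≡ order ks

module FromSystem {ks : List ℕ} {m e : ℕ} (sys : System ks m e) (m≥1 : 1 ≤ m) where
  open System sys

  triple : Pair ks → Triple ks
  triple (x , y) = 0G ks , x , x ⊕ y

  triples : List (Triple ks)
  triples = map triple pairs

  rest : List (Elt ks)
  rest = thirds ++ map (⊖_ {ks}) thirds ++ Δ triples

  everything : List (Elt ks)
  everything = 0G ks ∷ involutions ++ rest

  Meets⇒∈ : ∀ p {g} → Meets p g → g ∈ ΔT (triple p) × ⊖ g ∈ ΔT (triple p)
  Meets⇒∈ (x , y) fst = there (here (sym (trans (cong (x ⊕_) ⊖-0G) (⊕-identityʳ x)))) , here (sym (⊕-identityˡ _))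
  Meets⇒∈ (x , y) snd =
      there (there (there (there (there (here (sym (xyx⁻¹≈y x y)))))))
    , there (there (there (there (here (sym eq)))))
    where
    eq : x ⊝ (x ⊕ y) ≡ ⊖ y
    eq = begin
      x ⊕ (⊖ (x ⊕ y))       ≡⟨ cong (x ⊕_) (⊖-⊕-comm x y) ⟨
      x ⊕ ((⊖ x) ⊕ (⊖ y))   ≡⟨ ⊕-assoc x (⊖ x) (⊖ y) ⟨
      (x ⊕ (⊖ x)) ⊕ (⊖ y)   ≡⟨ cong (_⊕ (⊖ y)) (⊕-inverseʳ x) ⟩
      0G ks ⊕ (⊖ y)         ≡⟨ ⊕-identityˡ (⊖ y) ⟩
      ⊖ y                   ∎ where open ≡-Reasoning
  Meets⇒∈ (x , y) (sum refl) =
      there (there (there (here (sym (trans (cong ((x ⊕ y) ⊕_) ⊖-0G) (⊕-identityʳ _))))))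
    , there (there (here (sym (⊕-identityˡ _))))

  pairs⇒Δ : ∀ {g} ps → Any (λ p → Meets p g ⊎ Meets p (⊖ g)) ps → g ∈ Δ (map triple ps)
  pairs⇒Δ     (p ∷ ps) (here (inj₁ q)) = ∈-++⁺ˡ (proj₁ (Meets⇒∈ p q))
  pairs⇒Δ {g} (p ∷ ps) (here (inj₂ q)) = ∈-++⁺ˡ (subst (_∈ ΔT (triple p)) (⊖-involutive g) (proj₂ (Meets⇒∈ p q)))
  pairs⇒Δ     (p ∷ ps) (there i)       = ∈-++⁺ʳ (ΔT (triple p)) (pairs⇒Δ ps i)

  thirds⇒∈ : ∀ {g} ss → Any (λ s → g ≡ s ⊎ ⊖ g ≡ s) ss → g ∈ ss ⊎ g ∈ map (⊖_ {ks}) ss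
  thirds⇒∈     (s ∷ ss) (here (inj₁ refl)) = inj₁ (here refl)
  thirds⇒∈ {g} (s ∷ ss) (here (inj₂ refl)) = inj₂ (here (sym (⊖-involutive g)))
  thirds⇒∈     (s ∷ ss) (there i) with thirds⇒∈ ss i
  ... | inj₁ q = inj₁ (there q)
  ... | inj₂ q = inj₂ (there q)

  ∈-everything : ∀ g → g ∈ everything
  ∈-everything g with covered g
  ... | inj₁ (here p)  = here p
  ... | inj₁ (there p) = there (∈-++⁺ˡ p)
  ... | inj₂ (inj₁ q) with thirds⇒∈ thirds q
  ...   | inj₁ r = there (∈-++⁺ʳ involutions (∈-++⁺ˡ r))
  ...   | inj₂ r = there (∈-++⁺ʳ involutions (∈-++⁺ʳ thirds (∈-++⁺ˡ r)))
  ∈-everything g | inj₂ (inj₂ q) =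
    there (∈-++⁺ʳ involutions (∈-++⁺ʳ thirds (∈-++⁺ʳ (map (⊖_ {ks}) thirds) (pairs⇒Δ pairs q))))

  length-Δ : ∀ ps → length (Δ (map triple ps)) ≡ 6 * length ps
  length-Δ []       = refl
  length-Δ (p ∷ ps) = trans (cong (6 +_) (length-Δ ps)) (sym (*-suc 6 (length ps)))

  length-everything : length everything ≡ order ks
  length-everything = trans (cong suc eq) counted
    where
    open ≡-Reasoning
    i = length involutions
    t = length thirds
    eq : length (involutions ++ rest) ≡ i + 2 * t + 6 * length pairs
    eq = begin
      length (involutions ++ rest)                             ≡⟨ length-++ involutions ⟩
      i + length rest                                          ≡⟨ cong (i +_) (length-++ thirds) ⟩
      i + (t + length (map (⊖_ {ks}) thirds ++ Δ triples))            ≡⟨ cong (λ z → i + (t + z)) (length-++ (map (⊖_ {ks}) thirds)) ⟩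
      i + (t + (length (map (⊖_ {ks}) thirds) + length (Δ triples)))  ≡⟨ cong₂ (λ z w → i + (t + (z + w))) (length-map (⊖_ {ks}) thirds) (length-Δ pairs) ⟩
      i + (t + (t + 6 * length pairs))                         ≡⟨ cong (i +_) (+-assoc t t _) ⟨
      i + (t + t + 6 * length pairs)                           ≡⟨ +-assoc i (t + t) _ ⟨
      i + (t + t) + 6 * length pairs                           ≡⟨ cong (λ z → i + (t + z) + 6 * length pairs) (+-identityʳ t) ⟨
      i + 2 * t + 6 * length pairs                             ∎

  everything! : Unique everything
  everything! = covering⇒Unique ∈-everything length-everything

  0∉ : ∀ {x} → x ∈ involutions ++ rest → x ≢ 0G ks
  0∉ x∈ refl = All.lookup (AllPairs.head everything!) x∈ refl

  -- All disjointness between the parts is read off from the uniqueness of the single list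
  -- `everything`.
  split₁ = Unique-++⁻ involutions (AllPairs.tail everything!)
  split₂ = Unique-++⁻ thirds (proj₁ (proj₂ split₁))
  split₃ = Unique-++⁻ (map (⊖_ {ks}) thirds) (proj₁ (proj₂ split₂))

  inv! : Unique involutions
  inv! = proj₁ split₁
  thirds! : Unique thirds
  thirds! = proj₁ split₂
  Δ! : Unique (Δ triples)
  Δ! = proj₁ (proj₂ split₃)

  inv#rest : Disjoint involutions rest
  inv#rest = proj₂ (proj₂ split₁)
  thirds#neg : Disjoint thirds (map (⊖_ {ks}) thirds)
  thirds#neg (p , q) = proj₂ (proj₂ split₂) (p , ∈-++⁺ˡ q)
  thirds#Δ : Disjoint thirds (Δ triples)
  thirds#Δ (p , q) = proj₂ (proj₂ split₂) (p , ∈-++⁺ʳ (map (⊖_ {ks}) thirds) q)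
  neg#Δ : Disjoint (map (⊖_ {ks}) thirds) (Δ triples)
  neg#Δ = proj₂ (proj₂ split₃)

  ∈-Δ⇒∈-rest : ∀ {x} → x ∈ Δ triples → x ∈ rest
  ∈-Δ⇒∈-rest p = ∈-++⁺ʳ thirds (∈-++⁺ʳ (map (⊖_ {ks}) thirds) p)
  inv≢0 : ∀ {x} → x ∈ involutions → x ≢ 0G ks
  inv≢0 = 0∉ ∘ ∈-++⁺ˡ
  thirds≢0 : ∀ {x} → x ∈ thirds → x ≢ 0G ks
  thirds≢0 = 0∉ ∘ ∈-++⁺ʳ involutions ∘ ∈-++⁺ˡ
  neg∈rest : ∀ {x} → x ∈ map (⊖_ {ks}) thirds → x ∈ rest
  neg∈rest = ∈-++⁺ʳ thirds ∘ ∈-++⁺ˡ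
  neg≢0 : ∀ {x} → x ∈ map (⊖_ {ks}) thirds → x ≢ 0G ks
  neg≢0 = 0∉ ∘ ∈-++⁺ʳ involutions ∘ neg∈rest
  Δ≢0 : ∀ {x} → x ∈ Δ triples → x ≢ 0G ks
  Δ≢0 = 0∉ ∘ ∈-++⁺ʳ involutions ∘ ∈-Δ⇒∈-rest

  ⊖-⊝ : ∀ (a b : Elt ks) → ⊖ (a ⊝ b) ≡ b ⊝ a
  ⊖-⊝ a b = trans (sym (⊖-⊕-comm a (⊖ b))) (trans (cong ((⊖ a) ⊕_) (⊖-involutive b)) (⊕-comm _ b))

  -- An element of Δ equal to its own negative would be listed twice.
  ΔT-neg : ∀ {x} (t : Triple ks) → Unique (ΔT t) → x ∈ ΔT t → ⊖ x ≢ x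
  ΔT-neg (a , b , c) ((p ∷ _) ∷ _) (here refl) e = p (sym (trans (sym (⊖-⊝ a b)) e))
  ΔT-neg (a , b , c) ((p ∷ _) ∷ _) (there (here refl)) e = p (trans (sym (⊖-⊝ b a)) e)
  ΔT-neg (a , b , c) (_ ∷ _ ∷ (p ∷ _) ∷ _) (there (there (here refl))) e = p (sym (trans (sym (⊖-⊝ a c)) e))
  ΔT-neg (a , b , c) (_ ∷ _ ∷ (p ∷ _) ∷ _) (there (there (there (here refl)))) e = p (trans (sym (⊖-⊝ c a)) e)
  ΔT-neg (a , b , c) (_ ∷ _ ∷ _ ∷ _ ∷ (p ∷ _) ∷ _) (there (there (there (there (here refl))))) e = p (sym (trans (sym (⊖-⊝ b c)) e))
  ΔT-neg (a , b , c) (_ ∷ _ ∷ _ ∷ _ ∷ (p ∷ _) ∷ _) (there (there (there (there (there (here refl)))))) e = p (trans (sym (⊖-⊝ c b)) e)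

  Δ-neg : ∀ {x : Elt ks} (ts : List (Triple ks)) → Unique (Δ ts) → x ∈ Δ ts → ⊖ x ≢ x
  Δ-neg (t ∷ ts) u x∈ with ∈-++⁻ (ΔT t) x∈ | Unique-++⁻ (ΔT t) u
  ... | inj₁ p | u₁ , _      = ΔT-neg t u₁ p
  ... | inj₂ p | _ , u₂ , _  = Δ-neg ts u₂ p

  thirds-neg : ∀ {x} → x ∈ thirds → ⊖ x ≢ x
  thirds-neg x∈ eq = thirds#neg (x∈ , subst (_∈ map (⊖_ {ks}) thirds) eq (∈-map⁺ (⊖_ {ks}) x∈))

  -- `x` occurs somewhere in `everything`. Outside `involutions` each entry has its negative listed
  -- at a second place, so by uniqueness it cannot be its own negative.
  self-inverse⇒involution : ∀ {x} → IsInvolution x → x ∈ involutions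
  self-inverse⇒involution {x} (x≢0 , 2x≡0) with ∈-everything x
  ... | here p  = contradiction p x≢0
  ... | there p with ∈-++⁻ involutions p
  ...   | inj₁ q = q
  ...   | inj₂ q with ∈-++⁻ thirds q
  ...     | inj₁ r = contradiction (sym (⊕-inverseʳ-unique x x 2x≡0)) (thirds-neg r)
  ...     | inj₂ r with ∈-++⁻ (map (⊖_ {ks}) thirds) r
  ...       | inj₂ w = contradiction (sym (⊕-inverseʳ-unique x x 2x≡0)) (Δ-neg triples Δ! w)
  ...       | inj₁ w with ∈-map⁻ (⊖_ {ks}) w
  ...         | s , s∈ , refl = contradiction (trans (⊕-inverseʳ-unique (⊖ s) (⊖ s) 2x≡0) (⊖-involutive s)) (thirds-neg s∈)

  hasExactlyInvolutions : HasExactlyInvolutions ks (2 ^ m ∸ 1)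
  hasExactlyInvolutions = involutions , inv! , cong (_∸ 1) #involutions ,
    λ x → mk⇔ (λ x∈ → inv≢0 x∈ , All.lookup double≡0 x∈) self-inverse⇒involution

  ⟨_⟩₂ ⟨_⟩₃ : Elt ks → List (Elt ks)
  ⟨ x ⟩₂ = 0G ks ∷ x ∷ []
  ⟨ s ⟩₃ = 0G ks ∷ s ∷ ⊖ s ∷ []

  subgroup₂ : ∀ {x} → x ∈ involutions → IsSubgroup ks ⟨ x ⟩₂
  subgroup₂ {x} x∈ = ((inv≢0 x∈ ∘ sym ∷ []) ∷ [] ∷ []) , here refl , add , neg
    where
    2x≡0 = All.lookup double≡0 x∈
    add : ∀ {y z} → y ∈ ⟨ x ⟩₂ → z ∈ ⟨ x ⟩₂ → (y ⊕ z) ∈ ⟨ x ⟩₂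
    add (here refl)         z∈                  = subst (_∈ ⟨ x ⟩₂) (sym (⊕-identityˡ _)) z∈
    add (there (here refl)) (here refl)         = there (here (⊕-identityʳ x))
    add (there (here refl)) (there (here refl)) = here 2x≡0
    neg : ∀ {y} → y ∈ ⟨ x ⟩₂ → (⊖ y) ∈ ⟨ x ⟩₂
    neg (here refl)         = here ⊖-0G
    neg (there (here refl)) = there (here (sym (⊕-inverseʳ-unique x x 2x≡0)))

  subgroup₃ : ∀ {s} → s ∈ thirds → IsSubgroup ks ⟨ s ⟩₃
  subgroup₃ {s} s∈ =
      ((thirds≢0 s∈ ∘ sym ∷ neg≢0 (∈-map⁺ (⊖_ {ks}) s∈) ∘ sym ∷ []) ∷ (thirds-neg s∈ ∘ sym ∷ []) ∷ [] ∷ [])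
    , here refl , add , neg
    where
    2s = All.lookup double≡neg s∈
    -2s : (⊖ s) ⊕ (⊖ s) ≡ s
    -2s = trans (⊖-⊕-comm s s) (trans (cong ⊖_ 2s) (⊖-involutive s))
    add : ∀ {y z} → y ∈ ⟨ s ⟩₃ → z ∈ ⟨ s ⟩₃ → (y ⊕ z) ∈ ⟨ s ⟩₃
    add (here refl) z∈ = subst (_∈ ⟨ s ⟩₃) (sym (⊕-identityˡ _)) z∈
    add y∈@(there _) (here refl) = subst (_∈ ⟨ s ⟩₃) (sym (⊕-identityʳ _)) y∈
    add (there (here refl)) (there (here refl)) = there (there (here 2s))
    add (there (here refl)) (there (there (here refl))) = here (⊕-inverseʳ s)
    add (there (there (here refl))) (there (here refl)) = here (⊕-inverseˡ s)
    add (there (there (here refl))) (there (there (here refl))) = there (here -2s)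
    neg : ∀ {y} → y ∈ ⟨ s ⟩₃ → (⊖ y) ∈ ⟨ s ⟩₃
    neg (here refl) = here ⊖-0G
    neg (there (here refl)) = there (there (here refl))
    neg (there (there (here refl))) = there (here (⊖-involutive s))

  Σ₂ Σ₃ : List (List (Elt ks))
  Σ₂ = map ⟨_⟩₂ involutions
  Σ₃ = map ⟨_⟩₃ thirds

  trivInter₂₂ : ∀ {x y} → x ≢ y → TrivInter ⟨ x ⟩₂ ⟨ y ⟩₂
  trivInter₂₂ x≢y (here refl)         _                   = refl
  trivInter₂₂ x≢y (there (here refl)) (here refl)         = refl
  trivInter₂₂ x≢y (there (here refl)) (there (here refl)) = contradiction refl x≢y

  trivInter₂₃ : ∀ {x s} → x ≢ s → x ≢ ⊖ s → TrivInter ⟨ x ⟩₂ ⟨ s ⟩₃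
  trivInter₂₃ _ _ (here refl) _ = refl
  trivInter₂₃ _ _ (there (here refl)) (here refl) = refl
  trivInter₂₃ x≢s _ (there (here refl)) (there (here refl)) = contradiction refl x≢s
  trivInter₂₃ _ x≢-s (there (here refl)) (there (there (here refl))) = contradiction refl x≢-s

  trivInter₃₃ : ∀ {s t} → s ≢ t → s ≢ ⊖ t → TrivInter ⟨ s ⟩₃ ⟨ t ⟩₃
  trivInter₃₃ _ _ (here refl) _ = refl
  trivInter₃₃ _ _ (there _) (here refl) = refl
  trivInter₃₃ s≢t s≢-t (there (here refl)) (there (here refl)) = contradiction refl s≢t
  trivInter₃₃ s≢t s≢-t (there (here refl)) (there (there (here refl))) = contradiction refl s≢-t
  trivInter₃₃ {s} s≢t s≢-t (there (there (here refl))) (there (here eq)) =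
    contradiction (trans (sym (⊖-involutive s)) (cong ⊖_ eq)) s≢-t
  trivInter₃₃ {s} {t} s≢t s≢-t (there (there (here refl))) (there (there (here eq))) =
    contradiction (trans (sym (⊖-involutive s)) (trans (cong ⊖_ eq) (⊖-involutive t))) s≢t

  pairwise : ∀ {A B : Set} {R : B → B → Set} (f : A → B) {xs} → Unique xs →
             (∀ {x y} → x ∈ xs → y ∈ xs → x ≢ y → R (f x) (f y)) → AllPairs R (map f xs)
  pairwise f []       _ = []
  pairwise f (x∉ ∷ u) r =
    AllP.map⁺ (All.tabulate (λ y∈ → r (here refl) (there y∈) (All.lookup x∉ y∈)))
    ∷ pairwise f u (λ x∈ y∈ → r (there x∈) (there y∈))

  isPartialSpread : IsPartialSpreadType23 ks (2 ^ m ∸ 1) e Σ₂ Σ₃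
  isPartialSpread =
      ( AllP.++⁺ (AllP.map⁺ (All.tabulate subgroup₂)) (AllP.map⁺ (All.tabulate subgroup₃))
      , AllPairsP.++⁺
          (pairwise ⟨_⟩₂ inv! (λ _ _ → trivInter₂₂))
          (pairwise ⟨_⟩₃ thirds! (λ s∈ t∈ s≢t → trivInter₃₃ s≢t (λ { refl → thirds#neg (s∈ , ∈-map⁺ (⊖_ {ks}) t∈) })))
          (AllP.map⁺ (All.tabulate λ x∈ → AllP.map⁺ (All.tabulate λ s∈ →
            trivInter₂₃ (λ { refl → inv#rest (x∈ , ∈-++⁺ˡ s∈) })
                        (λ { refl → inv#rest (x∈ , neg∈rest (∈-map⁺ (⊖_ {ks}) s∈)) })))) )
    , AllP.map⁺ (All.universal (λ _ → refl) involutions)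
    , trans (length-map ⟨_⟩₂ involutions) (cong (_∸ 1) #involutions)
    , AllP.map⁺ (All.universal (λ _ → refl) thirds)
    , trans (length-map ⟨_⟩₃ thirds) #thirds

  ∈-Δ⇒∉-union : ∀ {x} → x ∈ Δ triples → ¬ InUnion x (Σ₂ ++ Σ₃)
  ∈-Δ⇒∉-union x∈Δ i with AnyP.++⁻ Σ₂ i
  ... | inj₁ j with find (AnyP.map⁻ j)
  ...   | y , y∈ , here refl                 = Δ≢0 x∈Δ refl
  ...   | y , y∈ , there (here refl)         = inv#rest (y∈ , ∈-Δ⇒∈-rest x∈Δ)
  ∈-Δ⇒∉-union x∈Δ i | inj₂ j with find (AnyP.map⁻ j)
  ...   | s , s∈ , here refl                 = Δ≢0 x∈Δ refl
  ...   | s , s∈ , there (here refl)         = thirds#Δ (s∈ , x∈Δ)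
  ...   | s , s∈ , there (there (here refl)) = neg#Δ (∈-map⁺ (⊖_ {ks}) s∈ , x∈Δ)

  -- Zero lies in every member of the spread, but a member must exist: without involutions 1 = 2 ^
  -- m, against m ≥ 1.
  0∈union : InUnion (0G ks) (Σ₂ ++ Σ₃)
  0∈union with involutions | #involutions
  ... | _ ∷ _ | _  = here (here refl)
  ... | []    | eq = contradiction eq (<⇒≢ (^-monoʳ-≤ 2 m≥1))

  ∉-union⇒∈-Δ : ∀ {x} → ¬ InUnion x (Σ₂ ++ Σ₃) → x ∈ Δ triples
  ∉-union⇒∈-Δ {x} x∉ with ∈-everything x
  ... | here refl = contradiction 0∈union x∉
  ... | there p with ∈-++⁻ involutions p
  ...   | inj₁ q = contradiction (AnyP.++⁺ˡ (AnyP.map⁺ (lose q (there (here refl))))) x∉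
  ...   | inj₂ q with ∈-++⁻ thirds q
  ...     | inj₁ r = contradiction (AnyP.++⁺ʳ Σ₂ (AnyP.map⁺ (lose r (there (here refl))))) x∉
  ...     | inj₂ r with ∈-++⁻ (map (⊖_ {ks}) thirds) r
  ...       | inj₂ w = w
  ...       | inj₁ w with ∈-map⁻ (⊖_ {ks}) w
  ...         | s , s∈ , refl = contradiction (AnyP.++⁺ʳ Σ₂ (AnyP.map⁺ (lose s∈ (there (there (here refl)))))) x∉

  -- Two equal entries of a triple would produce the difference zero.
  distinct : ∀ (ts : List (Triple ks)) → (∀ {x : Elt ks} → x ∈ Δ ts → x ≢ 0G ks) → All DistinctTriple ts
  distinct []                 _   = []
  distinct ((a , b , c) ∷ ts) nz =
      ( (λ { refl → nz (here refl) (⊕-inverseʳ a) })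
      , (λ { refl → nz (there (there (here refl))) (⊕-inverseʳ a) })
      , (λ { refl → nz (there (there (there (there (here refl))))) (⊕-inverseʳ b) }))
    ∷ distinct ts (nz ∘ ∈-++⁺ʳ (ΔT (a , b , c)))

  hasDF23 : HasDF23 ks (2 ^ m ∸ 1) e
  hasDF23 = Σ₂ , Σ₃ , triples , isPartialSpread , distinct triples Δ≢0 ,
    λ x → (λ x∈ → occ-∉ (λ x∈Δ → ∈-Δ⇒∉-union x∈Δ x∈)) , (λ x∉ → occ-∈-Unique Δ! (∉-union⇒∈-Δ x∉))

-- From G to ℤ₂² × G.

module Inflate {ks : List ℕ} {m e : ℕ} (sys : System ks m e) where
  open System sys

  ks⁺ : List ℕ
  ks⁺ = 1 ∷ 1 ∷ ks

  lift : Fin 2 → Fin 2 → Elt ks → Elt ks⁺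
  lift a b x = a , b , x

  -- w ↦ (w , φ w , w + φ w) with φ (a , b) = (b , a + b) runs through ℤ₂² in every coordinate.
  inflatePair : Elt (1 ∷ 1 ∷ []) × Pair ks → Pair ks⁺
  inflatePair ((a , b , _) , (x , y)) = lift a b x , lift b (a +ₘ b) y

  -- The sum of the two entries has last coordinate s + s = - s, so it is the negative of
  -- `lift 1F 1F s`. One pair thus settles, up to sign, all three lifts of `s` by a nonzero w.
  lineThird : Elt ks → Pair ks⁺
  lineThird s = lift 0F 1F s , lift 1F 0F s

  -- The witnesses are the preimages of (a , b) under the three bijections w, φ w and w + φ w.
  inflatePair-meets : ∀ a b p {g} → Meets p g → Σ (Elt (1 ∷ 1 ∷ [])) λ w → Meets (inflatePair (w , p)) (lift a b g)
  inflatePair-meets a b (x , y) fst = (a , b , tt) , fst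
  inflatePair-meets 0F 0F (x , y) snd = (0F , 0F , tt) , snd
  inflatePair-meets 0F 1F (x , y) snd = (1F , 0F , tt) , snd
  inflatePair-meets 1F 0F (x , y) snd = (1F , 1F , tt) , snd
  inflatePair-meets 1F 1F (x , y) snd = (0F , 1F , tt) , snd
  inflatePair-meets 0F 0F (x , y) (sum eq) = (0F , 0F , tt) , sum (cong (lift _ _) eq)
  inflatePair-meets 0F 1F (x , y) (sum eq) = (1F , 1F , tt) , sum (cong (lift _ _) eq)
  inflatePair-meets 1F 0F (x , y) (sum eq) = (0F , 1F , tt) , sum (cong (lift _ _) eq)
  inflatePair-meets 1F 1F (x , y) (sum eq) = (1F , 0F , tt) , sum (cong (lift _ _) eq)

  ⊖-lift : ∀ a b g → lift a b (⊖ g) ≡ ⊖ (lift a b g)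
  ⊖-lift 0F 0F g = refl
  ⊖-lift 0F 1F g = refl
  ⊖-lift 1F 0F g = refl
  ⊖-lift 1F 1F g = refl

  involutions⁺ : List (Elt ks⁺)
  involutions⁺ = map (lift 0F 0F) involutions ++ map (lift 0F 1F) (0G ks ∷ involutions)
              ++ map (lift 1F 0F) (0G ks ∷ involutions) ++ map (lift 1F 1F) (0G ks ∷ involutions)

  inflated : List (Pair ks⁺)
  inflated = map inflatePair (cartesianProduct (elements (1 ∷ 1 ∷ [])) pairs)

  pairs⁺ : List (Pair ks⁺)
  pairs⁺ = inflated ++ map lineThird thirds

  lift-involution : ∀ a b {g} → g ∈ 0G ks ∷ involutions → lift a b g ∈ 0G ks⁺ ∷ involutions⁺
  lift-involution 0F 0F (here refl) = here refl
  lift-involution 0F 0F (there i)   = there (∈-++⁺ˡ (∈-map⁺ (lift 0F 0F) i))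
  lift-involution 0F 1F i = there (∈-++⁺ʳ (map (lift 0F 0F) involutions) (∈-++⁺ˡ (∈-map⁺ (lift 0F 1F) i)))
  lift-involution 1F 0F i = there (∈-++⁺ʳ (map (lift 0F 0F) involutions)
    (∈-++⁺ʳ (map (lift 0F 1F) (0G ks ∷ involutions)) (∈-++⁺ˡ (∈-map⁺ (lift 1F 0F) i))))
  lift-involution 1F 1F i = there (∈-++⁺ʳ (map (lift 0F 0F) involutions)
    (∈-++⁺ʳ (map (lift 0F 1F) (0G ks ∷ involutions)) (∈-++⁺ʳ (map (lift 1F 0F) (0G ks ∷ involutions)) (∈-map⁺ (lift 1F 1F) i))))

  Third⁺ Covered⁺ : Elt ks⁺ → Set
  Third⁺ g = Any (λ s → g ≡ s ⊎ ⊖ g ≡ s) (map (lift 0F 0F) thirds)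
  Covered⁺ g = Any (λ p → Meets p g ⊎ Meets p (⊖ g)) pairs⁺

  lift-third : ∀ a b {g s} → s ∈ thirds → g ≡ s ⊎ ⊖ g ≡ s → Third⁺ (lift a b g) ⊎ Covered⁺ (lift a b g)
  lift-third a b s∈ (inj₁ refl) = lemma a b
    where
    lemma : ∀ a b → Third⁺ (lift a b _) ⊎ Covered⁺ (lift a b _)
    lemma 0F 0F = inj₁ (AnyP.map⁺ (lose s∈ (inj₁ refl)))
    lemma 0F 1F = inj₂ (AnyP.++⁺ʳ inflated (AnyP.map⁺ (lose s∈ (inj₁ fst))))
    lemma 1F 0F = inj₂ (AnyP.++⁺ʳ inflated (AnyP.map⁺ (lose s∈ (inj₁ snd))))
    lemma 1F 1F = inj₂ (AnyP.++⁺ʳ inflated (AnyP.map⁺ (lose s∈ (inj₂ (sum (cong (lift 1F 1F) (All.lookup double≡neg s∈)))))))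
  lift-third a b {g} s∈ (inj₂ refl) = lemma a b
    where
    lemma : ∀ a b → Third⁺ (lift a b g) ⊎ Covered⁺ (lift a b g)
    lemma 0F 0F = inj₁ (AnyP.map⁺ (lose s∈ (inj₂ refl)))
    lemma 0F 1F = inj₂ (AnyP.++⁺ʳ inflated (AnyP.map⁺ (lose s∈ (inj₂ fst))))
    lemma 1F 0F = inj₂ (AnyP.++⁺ʳ inflated (AnyP.map⁺ (lose s∈ (inj₂ snd))))
    lemma 1F 1F = inj₂ (AnyP.++⁺ʳ inflated (AnyP.map⁺ (lose s∈ (inj₁ (sum (cong (lift 1F 1F)
      (trans (All.lookup double≡neg s∈) (⊖-involutive g))))))))

  inflated⁺ : ∀ {p g} → p ∈ pairs → (Σ (Elt (1 ∷ 1 ∷ [])) λ w → Meets (inflatePair (w , p)) g) →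
              Any (λ p → Meets p g) pairs⁺
  inflated⁺ p∈ (w , q) = AnyP.++⁺ˡ (AnyP.map⁺ (lose (∈-cartesianProduct⁺ (∈-elements w) p∈) q))

  covered⁺ : ∀ g → g ∈ 0G ks⁺ ∷ involutions⁺ ⊎ Third⁺ g ⊎ Covered⁺ g
  covered⁺ (a , b , g) with covered g
  ... | inj₁ i = inj₁ (lift-involution a b i)
  ... | inj₂ (inj₁ t) with find t
  ...   | _ , s∈ , eq = inj₂ (lift-third a b s∈ eq)
  covered⁺ (a , b , g) | inj₂ (inj₂ c) with find c
  ...   | p , p∈ , inj₁ q = inj₂ (inj₂ (Any.map inj₁ (inflated⁺ p∈ (inflatePair-meets a b p q))))
  ...   | p , p∈ , inj₂ q = inj₂ (inj₂ (Any.map inj₂ (subst (λ h → Any (λ p → Meets p h) pairs⁺) (⊖-lift a b g)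
                              (inflated⁺ p∈ (inflatePair-meets a b p q)))))

  lift-double : ∀ a b {x} → x ⊕ x ≡ 0G ks → lift a b x ⊕ lift a b x ≡ 0G ks⁺
  lift-double 0F 0F eq = cong (lift 0F 0F) eq
  lift-double 0F 1F eq = cong (lift 0F 0F) eq
  lift-double 1F 0F eq = cong (lift 0F 0F) eq
  lift-double 1F 1F eq = cong (lift 0F 0F) eq

  length-involutions⁺ : suc (length involutions⁺) ≡ 4 * suc (length involutions)
  length-involutions⁺ = trans (cong suc (trans (length-++ (map (lift 0F 0F) involutions))
    (cong₂ _+_ (length-map (lift 0F 0F) involutions)
      (trans (length-++ (map (lift 0F 1F) i₀)) (cong₂ _+_ (length-map (lift 0F 1F) i₀)
        (trans (length-++ (map (lift 1F 0F) i₀)) (cong₂ _+_ (length-map (lift 1F 0F) i₀) (length-map (lift 1F 1F) i₀))))))))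
    (eq (length involutions))
    where
    i₀ = 0G ks ∷ involutions
    eq : ∀ n → suc (n + (suc n + (suc n + suc n))) ≡ 4 * suc n
    eq = solve-∀

  length-pairs⁺ : length pairs⁺ ≡ 4 * length pairs + length thirds
  length-pairs⁺ = trans (length-++ inflated) (cong₂ _+_
    (trans (length-map inflatePair (cartesianProduct (elements (1 ∷ 1 ∷ [])) pairs)) (length-cartesianProduct (elements (1 ∷ 1 ∷ [])) pairs))
    (length-map lineThird thirds))

  inflate : System ks⁺ (2 + m) e
  inflate = record
    { involutions = involutions⁺
    ; thirds      = map (lift 0F 0F) thirds
    ; pairs       = pairs⁺
    ; double≡0    = AllP.++⁺ (AllP.map⁺ (All.map (lift-double 0F 0F) double≡0))
                   (AllP.++⁺ (AllP.map⁺ (All.map (lift-double 0F 1F) zs))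
                   (AllP.++⁺ (AllP.map⁺ (All.map (lift-double 1F 0F) zs)) (AllP.map⁺ (All.map (lift-double 1F 1F) zs))))
    ; double≡neg  = AllP.map⁺ (All.map (cong (lift 0F 0F)) double≡neg)
    ; #involutions = trans length-involutions⁺ (trans (cong (4 *_) #involutions) (*-assoc 2 2 (2 ^ m)))
    ; #thirds     = trans (length-map (lift 0F 0F) thirds) #thirds
    ; covered     = covered⁺
    ; counted     = begin
        suc (length involutions⁺) + 2 * length (map (lift 0F 0F) thirds) + 6 * length pairs⁺
          ≡⟨ cong₂ _+_ (cong₂ (λ i t → i + 2 * t) length-involutions⁺ (length-map (lift 0F 0F) thirds)) (cong (6 *_) length-pairs⁺) ⟩
        4 * suc (length involutions) + 2 * length thirds + 6 * (4 * length pairs + length thirds)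
          ≡⟨ eq (suc (length involutions)) (length thirds) (length pairs) ⟩
        2 * (2 * (suc (length involutions) + 2 * length thirds + 6 * length pairs))
          ≡⟨ cong (λ n → 2 * (2 * n)) counted ⟩
        2 * (2 * order ks) ∎
    }
    where
    open ≡-Reasoning
    zs : All (λ x → x ⊕ x ≡ 0G ks) (0G ks ∷ involutions)
    zs = ⊕-identityˡ (0G ks) ∷ double≡0
    -- Of the 8 t lifts of the 2 t elements of order 3, 2 t stay excluded and 6 t are the
    -- differences from the t pairs `lineThird`.
    eq : ∀ i t p → 4 * i + 2 * t + 6 * (4 * p + t) ≡ 2 * (2 * (i + 2 * t + 6 * p))
    eq = solve-∀

-- Reduction to heights 0, ..., N in ℤ_{2N} × V.

Covers : ∀ {ks} → List (Pair ks) → Elt ks → Set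
Covers T g = Any (λ p → Meets p g ⊎ Meets p (⊖ g)) T

Third : ∀ {ks} → List (Elt ks) → Elt ks → Set
Third S g = Any (λ s → g ≡ s ⊎ ⊖ g ≡ s) S

module Base {k : ℕ} {ks : List ℕ} (N : ℕ) (modulus : suc k ≡ N + N)
            (torsion : List (Elt ks)) (2-torsion : All (λ (v : Elt ks) → v ⊕ v ≡ 0G ks) torsion)
            (S : List (Elt (k ∷ ks))) (3-torsion : All (λ (s : Elt (k ∷ ks)) → s ⊕ s ≡ ⊖ s) S)
            (T : List (Pair (k ∷ ks))) where

  Resolved : ℕ → Elt ks → Set
  Resolved h v = Third S (ι h , v) ⊎ Covers T (ι h , v)

  torsion₀ : List (Elt ks)
  torsion₀ = 0G ks ∷ torsion

  2-torsion₀ : All (λ v → v ⊕ v ≡ 0G ks) torsion₀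
  2-torsion₀ = ⊕-identityˡ _ ∷ 2-torsion

  ιN+ιN : ι {k} N +ₘ ι N ≡ Fin.zero
  ιN+ιN = trans (sym (ι-+ N N)) (trans (cong ι (sym modulus)) ι-modulus)

  inv : List (Elt (k ∷ ks))
  inv = map (Fin.zero ,_) torsion ++ map (ι N ,_) torsion₀

  inv-double : All (λ x → x ⊕ x ≡ 0G (k ∷ ks)) inv
  inv-double = AllP.++⁺ (AllP.map⁺ (All.map (cong₂ _,_ (+ₘ-identityˡ _)) 2-torsion))
                        (AllP.map⁺ (All.map (cong₂ _,_ ιN+ιN) 2-torsion₀))

  length-inv : suc (length inv) ≡ 2 * length torsion₀
  length-inv = begin
    suc (length inv)                       ≡⟨ cong suc (length-++ {A = Elt (k ∷ ks)} (map (Fin.zero ,_) torsion)) ⟩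
    suc (length (map {B = Elt (k ∷ ks)} (Fin.zero ,_) torsion) + length (map {B = Elt (k ∷ ks)} (ι N ,_) torsion₀))
      ≡⟨ cong suc (cong₂ _+_ (length-map _ torsion) (length-map _ torsion₀)) ⟩
    length torsion₀ + length torsion₀      ≡⟨ cong (length torsion₀ +_) (+-identityʳ _) ⟨
    2 * length torsion₀ ∎ where open ≡-Reasoning

  Good : Elt (k ∷ ks) → Set
  Good g = g ∈ 0G (k ∷ ks) ∷ inv ⊎ Third S g ⊎ Covers T g

  -- Zero and the involutions are their own negatives, and the other two alternatives are stated up
  -- to sign. Hence heights above N need no separate treatment.
  Good-⊖ : ∀ g → Good (⊖ g) → Good g
  Good-⊖ g (inj₁ i) = inj₁ (subst (_∈ 0G (k ∷ ks) ∷ inv) (trans (sym eq) (⊖-involutive g)) i)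
    where
    eq : ⊖ (⊖ g) ≡ ⊖ g
    eq = sym (⊕-inverseʳ-unique (⊖ g) (⊖ g) (All.lookup (⊕-identityˡ (0G (k ∷ ks)) ∷ inv-double) i))
  Good-⊖ g (inj₂ (inj₁ t)) = inj₂ (inj₁ (Any.map (λ { (inj₁ e) → inj₂ e ; (inj₂ e) → inj₁ (trans (sym (⊖-involutive g)) e) }) t))
  Good-⊖ g (inj₂ (inj₂ c)) = inj₂ (inj₂ (Any.map (λ { (inj₁ e) → inj₂ e ; (inj₂ e) → inj₁ (subst (Meets _) (⊖-involutive g) e) }) c))

  module _ (axis   : ∀ (v : Elt ks) → v ∈ torsion₀ ⊎ Resolved 0 v)
           (middle : ∀ (v : Elt ks) → v ∈ torsion₀ ⊎ Resolved N v)
           (inner  : ∀ (h : ℕ) (v : Elt ks) → 1 ≤ h → h < N → Resolved h v) where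

    lower : ∀ h v → h ≤ N → Good (ι h , v)
    lower zero v _ with axis v
    ... | inj₁ (here refl) = inj₁ (here refl)
    ... | inj₁ (there i)   = inj₁ (there (∈-++⁺ˡ (∈-map⁺ _ i)))
    ... | inj₂ r           = inj₂ r
    lower (suc h) v h≤N with suc h ≟ N
    ... | no h≢N = inj₂ (inner (suc h) v (s≤s z≤n) (≤∧≢⇒< h≤N h≢N))
    ... | yes refl with middle v
    ...   | inj₁ i = inj₁ (there (∈-++⁺ʳ (map (Fin.zero ,_) torsion) (∈-map⁺ _ i)))
    ...   | inj₂ r = inj₂ r

    good : ∀ g → Good g
    good (a , v) with toℕ a ≤? N
    ... | yes a≤N = subst (λ b → Good (b , v)) (ι-toℕ a) (lower (toℕ a) v a≤N)
    -- By definition `-ₘ a` is `ι (suc k ∸ toℕ a)`, so the negative is presented by a height at most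
    -- N.
    ... | no  a≰N = Good-⊖ (a , v) (lower (suc k ∸ toℕ a) (⊖ v) bound)
      where
      bound : suc k ∸ toℕ a ≤ N
      bound = subst (λ M → M ∸ toℕ a ≤ N) (sym modulus)
        (≤-trans (∸-monoʳ-≤ (N + N) (<⇒≤ (≰⇒> a≰N))) (≤-reflexive (m+n∸n≡m N N)))

    system : ∀ {m e} → 2 * length torsion₀ ≡ 2 ^ m → length S ≡ e →
             2 * length torsion₀ + 2 * length S + 6 * length T ≡ suc k * order ks → System (k ∷ ks) m e
    system #inv #S count = record
      { involutions = inv ; thirds = S ; pairs = T ; double≡0 = inv-double ; double≡neg = 3-torsion
      ; #involutions = trans length-inv #inv ; #thirds = #S ; covered = good
      ; counted = trans (cong (λ i → i + 2 * length S + 6 * length T) length-inv) count }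

-- Edges: halves at three heights of different colours.

-- blocks a b c uses up the halves fx = a, fy = b, fz = c at three heights i, l, i + l.
record Frame {ks : List ℕ} (fx fy fz : Elt ks → Bool) : Set where
  field
    size   : ℕ
    blocks : Bool → Bool → Bool → List (Pair ks)
    length-blocks : ∀ a b c → length (blocks a b c) ≡ size
    hits-x : ∀ v b c → Any (λ p → proj₁ p ≡ v) (blocks (fx v) b c)
    hits-y : ∀ v a c → Any (λ p → proj₂ p ≡ v) (blocks a (fy v) c)
    hits-z : ∀ v a b → Any (λ p → proj₁ p ⊕ proj₂ p ≡ v) (blocks a b (fz v))

data End : Set where
  lo hi : End

place : ∀ {k ks} → ℕ → ℕ → Pair ks → Pair (k ∷ ks)
place i j (p , q) = (ι i , p) , (ι j , q)

module Edges {k : ℕ} {ks : List ℕ} {fx fy fz : Elt ks → Bool} (F : Frame fx fy fz) where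
  open Frame F

  -- The edge joins the vertices l and i + l, coloured by `fy` and `fz`. Its label is their
  -- difference i, coloured by `fx`; the three bits select the halves.
  edge : Bool → Bool → Bool → ℕ → ℕ → List (Pair (k ∷ ks))
  edge a b c i l = map (place i l) (blocks a b c)

  edge-label : ∀ {a b c} i l v → fx v ≡ a → Covers (edge a b c i l) (ι i , v)
  edge-label {b = b} {c} i l v refl = AnyP.map⁺ (Any.map (λ { refl → inj₁ fst }) (hits-x v b c))

  edge-lo : ∀ {a b c} i l v → fy v ≡ b → Covers (edge a b c i l) (ι l , v)
  edge-lo {a} {c = c} i l v refl = AnyP.map⁺ (Any.map (λ { refl → inj₁ snd }) (hits-y v a c))

  edge-hi : ∀ {a b c h} i l v → fz v ≡ c → h ≡ i + l → Covers (edge a b c i l) (ι h , v)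
  edge-hi {a} {b} i l v refl refl = AnyP.map⁺
    (Any.map (λ eq → inj₁ (sum (cong₂ _,_ (sym (ι-+ i l)) eq))) (hits-z v a b))

  length-edge : ∀ a b c i l → length (edge a b c i l) ≡ size
  length-edge a b c i l = trans (length-map (place i l) (blocks a b c)) (length-blocks a b c)

-- Zigzag walks and what they leave over.

colour : ∀ {A : Set} → A → A → End → A
colour y z lo = y
colour y z hi = z

-- A zigzag through [ b , b + n + r ]: start at one end and keep jumping to the other end of what has not
-- been visited.  After n jumps it stands at end rest-end of the interval [ rest-from , rest-from + r ].
at : ℕ → End → ℕ → ℕ → ℕ
at r lo n b = b
at r hi n b = b + (n + r)

at-end : ∀ o b → at 0 o 0 b ≡ b
at-end lo b = refl
at-end hi b = +-identityʳ b

rest-end : End → ℕ → End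
rest-end o  zero    = o
rest-end lo (suc n) = rest-end hi n
rest-end hi (suc n) = rest-end lo n

rest-from : End → ℕ → ℕ → ℕ
rest-from o  zero    b = b
rest-from lo (suc n) b = rest-from hi n (suc b)
rest-from hi (suc n) b = rest-from lo n b

-- The two walks of a construction are translates of each other, so the places where they stop
-- differ by the length of the translation. This supplies the relation for an edge between them.
rest-from-+ : ∀ o n b c → rest-from o n (b + c) ≡ rest-from o n b + c
rest-from-+ o  zero    b c = refl
rest-from-+ lo (suc n) b c = rest-from-+ hi n (suc b) c
rest-from-+ hi (suc n) b c = rest-from-+ lo n b c

split-side : ∀ x s → x ≡ s ⊎ x ≡ not s
split-side false false = inj₁ refl
split-side false true  = inj₂ refl
split-side true  false = inj₂ refl
split-side true  true  = inj₁ refl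

module Walks {k : ℕ} {ks : List ℕ} {fx fy fz : Elt ks → Bool} (F : Frame fx fy fz)
             (a s : Bool) (r : ℕ) where
  open Frame F
  open Edges {k} F

  -- Vertices on the lower side carry `fy`, those on the upper side `fz`. Each vertex is entered
  -- through its half `s` and left through its half `not s`, so a vertex passed by the walk is used
  -- up. The labels go down from n + r to r + 1.
  walk : End → ℕ → ℕ → List (Pair (k ∷ ks))
  walk o  zero    b = []
  walk lo (suc n) b = edge a (not s) s (suc (n + r)) b ++ walk hi n (suc b)
  walk hi (suc n) b = edge a s (not s) (suc (n + r)) b ++ walk lo n b

  length-walk : ∀ o n b → length (walk o n b) ≡ n * size
  length-walk o  zero    b = refl
  length-walk lo (suc n) b = trans (length-++ (edge a (not s) s (suc (n + r)) b))
    (cong₂ _+_ (length-edge a (not s) s (suc (n + r)) b) (length-walk hi n (suc b)))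
  length-walk hi (suc n) b = trans (length-++ (edge a s (not s) (suc (n + r)) b))
    (cong₂ _+_ (length-edge a s (not s) (suc (n + r)) b) (length-walk lo n b))

  walk-label : ∀ o n b i v → r < i → i ≤ n + r → fx v ≡ a → Covers (walk o n b) (ι i , v)
  walk-label o zero b i v r<i i≤r _ = contradiction i≤r (<⇒≱ r<i)
  walk-label o (suc n) b i v r<i i≤ eq with i ≟ suc (n + r)
  walk-label lo (suc n) b i v r<i i≤ eq | yes refl = AnyP.++⁺ˡ (edge-label (suc (n + r)) b v eq)
  walk-label hi (suc n) b i v r<i i≤ eq | yes refl = AnyP.++⁺ˡ (edge-label (suc (n + r)) b v eq)
  walk-label lo (suc n) b i v r<i i≤ eq | no i≢ =
    AnyP.++⁺ʳ (edge a (not s) s (suc (n + r)) b) (walk-label hi n (suc b) i v r<i (s≤s⁻¹ (≤∧≢⇒< i≤ i≢)) eq)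
  walk-label hi (suc n) b i v r<i i≤ eq | no i≢ =
    AnyP.++⁺ʳ (edge a s (not s) (suc (n + r)) b) (walk-label lo n b i v r<i (s≤s⁻¹ (≤∧≢⇒< i≤ i≢)) eq)

  f : End → Elt ks → Bool
  f = colour fy fz

  -- The leftovers: the half `s` of the first vertex, which no edge enters, and the rest interval.
  -- At the vertex where the walk stops only `not s` is left; the other heights of that interval are
  -- untouched.
  Start Rest : End → ℕ → ℕ → ℕ → Elt ks → Set
  Start o n b h v = h ≡ at r o n b × f o v ≡ s
  Rest o n b h v = rest-from o n b ≤ h × h ≤ rest-from o n b + r
    × (h ≡ at r (rest-end o n) 0 (rest-from o n b) → f (rest-end o n) v ≡ not s)

  -- Induction on the number of jumps: the first edge uses the half `not s` of the first vertex, and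
  -- the shorter walk deals with the remaining interval.
  walk-vertex : ∀ o n b h v → b ≤ h → h ≤ b + (n + r) →
                Covers (walk o n b) (ι h , v) ⊎ Start o n b h v ⊎ Rest o n b h v
  walk-vertex o zero b h v b≤h h≤ with h ≟ at r o 0 b
  ... | no  h≢   = inj₂ (inj₂ (b≤h , h≤ , λ h≡ → contradiction h≡ h≢))
  ... | yes h≡ with split-side (f o v) s
  ...   | inj₁ eq = inj₂ (inj₁ (h≡ , eq))
  ...   | inj₂ eq = inj₂ (inj₂ (b≤h , h≤ , λ _ → eq))
  walk-vertex lo (suc n) b h v b≤h h≤ with b ≟ h
  ... | yes refl with split-side (fy v) s
  ...   | inj₁ eq = inj₂ (inj₁ (refl , eq))
  ...   | inj₂ eq = inj₁ (AnyP.++⁺ˡ (edge-lo (suc (n + r)) b v eq))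
  walk-vertex lo (suc n) b h v b≤h h≤ | no b≢h
    with walk-vertex hi n (suc b) h v (≤∧≢⇒< b≤h b≢h) (subst (h ≤_) (+-suc b (n + r)) h≤)
  ... | inj₁ c               = inj₁ (AnyP.++⁺ʳ (edge a (not s) s (suc (n + r)) b) c)
  -- The shorter walk misses the half `s` of its own first vertex, which is where the edge just made
  -- arrives.
  ... | inj₂ (inj₁ (eq , e)) = inj₁ (AnyP.++⁺ˡ (edge-hi (suc (n + r)) b v e (trans eq (cong suc (+-comm b (n + r))))))
  ... | inj₂ (inj₂ x)        = inj₂ (inj₂ x)
  walk-vertex hi (suc n) b h v b≤h h≤ with h ≟ b + suc (n + r)
  ... | yes eq with split-side (fz v) s
  ...   | inj₁ e = inj₂ (inj₁ (eq , e))
  ...   | inj₂ e = inj₁ (AnyP.++⁺ˡ (edge-hi (suc (n + r)) b v e (trans eq (+-comm b (suc (n + r))))))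
  walk-vertex hi (suc n) b h v b≤h h≤ | no h≢
    with walk-vertex lo n b h v b≤h (s≤s⁻¹ (subst (h <_) (+-suc b (n + r)) (≤∧≢⇒< h≤ h≢)))
  ... | inj₁ c                 = inj₁ (AnyP.++⁺ʳ (edge a s (not s) (suc (n + r)) b) c)
  ... | inj₂ (inj₁ (refl , e)) = inj₁ (AnyP.++⁺ˡ (edge-lo (suc (n + r)) b v e))
  ... | inj₂ (inj₂ x)          = inj₂ (inj₂ x)

-- The frames on ℤ₂², ℤ₂³ and ℤ₂² × ℤ₃, verified by decision.

∀Bool? : ∀ {P : Bool → Set} → (∀ b → Dec (P b)) → Dec (∀ b → P b)
∀Bool? P? with P? false | P? true
... | yes p | yes q = yes λ { false → p ; true → q }
... | no ¬p | _     = no λ f → ¬p (f false)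
... | _     | no ¬q = no λ f → ¬q (f true)

∀Elt? : ∀ {ks} {P : Elt ks → Set} → (∀ v → Dec (P v)) → Dec (∀ v → P v)
∀Elt? {ks} P? = map′ (λ all v → All.lookup all (∈-elements v)) (λ f → All.tabulate λ {v} _ → f v) (All.all? P? (elements ks))

bit : Bool → Fin 2
bit false = 0F
bit true  = 1F

isOne : Fin 2 → Bool
isOne 0F = false
isOne 1F = true

bools : List Bool
bools = false ∷ true ∷ []

module _ {ks : List ℕ} (fx fy fz : Elt ks → Bool) (blocks : Bool → Bool → Bool → List (Pair ks)) where

  hits-x? : Dec (∀ v b c → Any (λ p → proj₁ p ≡ v) (blocks (fx v) b c))
  hits-x? = ∀Elt? λ v → ∀Bool? λ b → ∀Bool? λ c → Any.any? (λ p → proj₁ p ≟G v) _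

  hits-y? : Dec (∀ v a c → Any (λ p → proj₂ p ≡ v) (blocks a (fy v) c))
  hits-y? = ∀Elt? λ v → ∀Bool? λ a → ∀Bool? λ c → Any.any? (λ p → proj₂ p ≟G v) _

  hits-z? : Dec (∀ v a b → Any (λ p → proj₁ p ⊕ proj₂ p ≡ v) (blocks a b (fz v)))
  hits-z? = ∀Elt? λ v → ∀Bool? λ a → ∀Bool? λ b → Any.any? (λ p → (proj₁ p ⊕ proj₂ p) ≟G v) _

module Dim2 where
  V = Elt (1 ∷ 1 ∷ [])
  fx fy fz : V → Bool
  fx (a , b , _) = isOne b
  fy (a , b , _) = isOne a
  fz (a , b , _) = isOne a xor isOne b

  -- `x` and `y` fix one coordinate of each entry, and the last coordinate of the second entry is
  -- forced by the value `z` of `fz` on the sum. As a varies, the entries and their sum each run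
  -- through a half.
  blocks : Bool → Bool → Bool → List (Pair (1 ∷ 1 ∷ []))
  blocks x y z = map (λ a → (bit a , bit x , tt) , (bit y , bit (a xor (x xor (y xor z))) , tt)) bools

  frame : Frame fx fy fz
  frame = record { size = 2 ; blocks = blocks ; length-blocks = λ _ _ _ → refl
    ; hits-x = toWitness {a? = hits-x? fx fy fz blocks} tt
    ; hits-y = toWitness {a? = hits-y? fx fy fz blocks} tt
    ; hits-z = toWitness {a? = hits-z? fx fy fz blocks} tt }

  double : ∀ (v : V) → v ⊕ v ≡ 0G _
  double = toWitness {a? = ∀Elt? λ v → (v ⊕ v) ≟G 0G _} tt

module Dim3 where
  V = Elt (1 ∷ 1 ∷ 1 ∷ [])
  fx fy fz : V → Bool
  fx (a , b , c , _) = isOne c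
  fy (a , b , c , _) = isOne b
  fz (a , b , c , _) = isOne a xor (isOne b xor isOne c)

  -- The second entry carries b and a in its outer coordinates, so up to constants the sum has b and
  -- a in its last two. Hence all three run through four values; the constant added to b gives `fz`
  -- the value `z` on the sum.
  blocks : Bool → Bool → Bool → List (Pair (1 ∷ 1 ∷ 1 ∷ []))
  blocks x y z = cartesianProductWith
    (λ a b → (bit a , bit b , bit x , tt) , (bit (b xor (x xor (y xor z))) , bit y , bit a , tt)) bools bools

  frame : Frame fx fy fz
  frame = record { size = 4 ; blocks = blocks ; length-blocks = λ _ _ _ → refl
    ; hits-x = toWitness {a? = hits-x? fx fy fz blocks} tt
    ; hits-y = toWitness {a? = hits-y? fx fy fz blocks} tt
    ; hits-z = toWitness {a? = hits-z? fx fy fz blocks} tt }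

  double : ∀ (v : V) → v ⊕ v ≡ 0G _
  double = toWitness {a? = ∀Elt? λ v → (v ⊕ v) ≟G 0G _} tt

module Dim2×3 where
  V = Elt (1 ∷ 1 ∷ 2 ∷ [])
  fx fy fz : V → Bool
  fx (a , b , _) = isOne b
  fy (a , b , _) = isOne a
  fz (a , b , _) = isOne a xor isOne b

  -- Both entries have the same ℤ₃ coordinate u. The sum has 2 u, and doubling is a bijection of ℤ₃.
  blocks : Bool → Bool → Bool → List (Pair (1 ∷ 1 ∷ 2 ∷ []))
  blocks x y z = cartesianProductWith
    (λ a u → (bit a , bit x , u , tt) , (bit y , bit (a xor (x xor (y xor z))) , u , tt)) bools (0F ∷ 1F ∷ 2F ∷ [])

  frame : Frame fx fy fz
  frame = record { size = 6 ; blocks = blocks ; length-blocks = λ _ _ _ → refl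
    ; hits-x = toWitness {a? = hits-x? fx fy fz blocks} tt
    ; hits-y = toWitness {a? = hits-y? fx fy fz blocks} tt
    ; hits-z = toWitness {a? = hits-z? fx fy fz blocks} tt }

-- The pair (p , p + q) has sum 2 p + q = q, so the second entry and the sum trade places.
swap : ∀ {ks} {fx fy fz : Elt ks → Bool} → (∀ v → v ⊕ v ≡ 0G ks) → Frame fx fy fz → Frame fx fz fy
swap {ks} double F = record
  { size = size
  ; blocks = λ a b c → map exchange (blocks a c b)
  ; length-blocks = λ a b c → trans (length-map exchange (blocks a c b)) (length-blocks a c b)
  ; hits-x = λ v b c → AnyP.map⁺ (hits-x v c b)
  ; hits-y = λ v a c → AnyP.map⁺ (hits-z v a c)
  ; hits-z = λ v a b → AnyP.map⁺ (Any.map (λ {p} → trans (cancel (proj₁ p) (proj₂ p))) (hits-y v a b)) }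
  where
  open Frame F
  exchange : Pair ks → Pair ks
  exchange (p , q) = p , p ⊕ q
  cancel : ∀ p q → p ⊕ (p ⊕ q) ≡ q
  cancel p q = trans (sym (⊕-assoc p p q)) (trans (cong (_⊕ q) (double p)) (⊕-identityˡ q))

-- The case `d` ≡ ± 1 (mod 6).

nonzero : ∀ ks → List (Elt ks)
nonzero ks = drop 1 (elements ks)

module CaseOne {ks : List ℕ} {fx fy fz : Elt ks → Bool} (F : Frame fx fy fz)
               (double : ∀ (v : Elt ks) → v ⊕ v ≡ 0G ks)
               (order-size : 2 * Frame.size F ≡ order ks)
               (elements-0 : elements ks ≡ 0G ks ∷ nonzero ks) where
  open Frame F using (size)

  F′ : Frame fx fz fy
  F′ = swap double F

  -- The edge joining the last vertices of the two walks has `fy` or `fz` at its lower vertex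
  -- according to the side on which the walks stop.
  oriented : ∀ o → Frame fx (colour fy fz o) (colour fz fy o)
  oriented lo = F
  oriented hi = F′

  length-oriented : ∀ {k} o a b c i l → length (Edges.edge {k} (oriented o) a b c i l) ≡ size
  length-oriented lo = Edges.length-edge F
  length-oriented hi = Edges.length-edge F′

  length-elements-0 : suc (length (nonzero ks)) ≡ order ks
  length-elements-0 = trans (cong length (sym elements-0)) (length-elements ks)

  ∈-torsion : ∀ v → v ∈ 0G ks ∷ nonzero ks
  ∈-torsion v = subst (v ∈_) elements-0 (∈-elements v)

  2-torsion : All (λ v → v ⊕ v ≡ 0G ks) (nonzero ks)
  2-torsion = All.universal double _

  module _ (n : ℕ) where
    -- Strictly between 0 and N lie t labels and then two intervals of t vertices, one for each
    -- walk.
    t N k : ℕ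
    t = suc n
    N = suc (t + t + t)
    -- In this form `suc k` is `N + N` by definition.
    k = t + t + t + N

    module W₁ = Walks {k} F false false 0
    -- The swapped frame gives corresponding vertices of the two walks, which are t apart, different
    -- colours, so that an edge with label t can join them.
    module W₂ = Walks {k} F′ true false 0

    o : End
    o = rest-end lo n
    c : ℕ
    c = rest-from lo n (suc t)

    module E₁ = Edges {k} F
    module E₂ = Edges {k} (oriented o)

    w₁ w₂ e₁ e₂ T : List (Pair (k ∷ ks))
    w₁ = W₁.walk lo n (suc t)
    w₂ = W₂.walk lo n (suc t + t)
    e₁ = E₁.edge false false false t (suc t)
    e₂ = E₂.edge true true true t c
    T  = w₁ ++ w₂ ++ e₁ ++ e₂

    in-w₁ : ∀ {g} → Covers w₁ g → Covers T g
    in-w₁ = AnyP.++⁺ˡ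
    in-w₂ : ∀ {g} → Covers w₂ g → Covers T g
    in-w₂ x = AnyP.++⁺ʳ w₁ (AnyP.++⁺ˡ x)
    in-e₁ : ∀ {g} → Covers e₁ g → Covers T g
    in-e₁ x = AnyP.++⁺ʳ w₁ (AnyP.++⁺ʳ w₂ (AnyP.++⁺ˡ x))
    in-e₂ : ∀ {g} → Covers e₂ g → Covers T g
    in-e₂ x = AnyP.++⁺ʳ w₁ (AnyP.++⁺ʳ w₂ (AnyP.++⁺ʳ e₁ x))

    -- At a label below t the first walk uses the half `false` and the second the half `true`; at t
    -- the edges `e₁` and `e₂` do so. Their other ends are exactly the halves missing at the first
    -- and at the last vertices.
    inner : ∀ h v → 1 ≤ h → h < N → Covers T (ι h , v)
    inner h v 1≤h h<N with <-cmp h t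
    ... | tri< h<t _ _ with fx v in eq
    ...   | false = in-w₁ (W₁.walk-label lo n (suc t) h v 1≤h (subst (h ≤_) (sym (+-identityʳ n)) (s≤s⁻¹ h<t)) eq)
    ...   | true  = in-w₂ (W₂.walk-label lo n (suc t + t) h v 1≤h (subst (h ≤_) (sym (+-identityʳ n)) (s≤s⁻¹ h<t)) eq)
    inner h v 1≤h h<N | tri≈ _ refl _ with fx v in eq
    ...   | false = in-e₁ (E₁.edge-label t (suc t) v eq)
    ...   | true  = in-e₂ (E₂.edge-label t c v eq)
    inner h v 1≤h h<N | tri> _ _ t<h with h ≤? t + t
    ... | yes h≤ with W₁.walk-vertex lo n (suc t) h v t<h
                      (≤-trans h≤ (≤-reflexive (trans (+-suc t n) (cong (suc t +_) (sym (+-identityʳ n))))))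
    ...   | inj₁ x = in-w₁ x
    ...   | inj₂ (inj₁ (refl , e)) = in-e₁ (E₁.edge-lo t (suc t) v e)
    ...   | inj₂ (inj₂ (c≤h , h≤c , e)) = in-e₂ (last (≤-antisym (subst (h ≤_) (+-identityʳ c) h≤c) c≤h))
      where
      last : h ≡ c → Covers e₂ (ι h , v)
      last refl = E₂.edge-lo t c v (e (sym (at-end o c)))
    inner h v 1≤h h<N | tri> _ _ t<h | no h≰
      with W₂.walk-vertex lo n (suc t + t) h v (≰⇒> h≰)
             (≤-trans (s≤s⁻¹ h<N) (≤-reflexive (trans (+-suc (t + t) n) (cong (suc (t + t) +_) (sym (+-identityʳ n))))))
    ... | inj₁ x = in-w₂ x
    ... | inj₂ (inj₁ (eq , e)) = in-e₁ (E₁.edge-hi t (suc t) v e (trans eq (sym (+-suc t t))))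
    ... | inj₂ (inj₂ (c≤h , h≤c , e)) = in-e₂ (E₂.edge-hi t c v (e (trans h≡ (sym (at-end o _))))
                                          (trans h≡ (trans (rest-from-+ lo n (suc t) t) (+-comm c t))))
      where
      h≡ : h ≡ rest-from lo n (suc t + t)
      h≡ = ≤-antisym (subst (h ≤_) (+-identityʳ _) h≤c) c≤h

    length-T : length T ≡ 2 * t * size
    length-T = begin
      length T   ≡⟨ length-++ w₁ ⟩
      length w₁ + length (w₂ ++ e₁ ++ e₂) ≡⟨ cong (length w₁ +_) (length-++ w₂) ⟩
      length w₁ + (length w₂ + length (e₁ ++ e₂)) ≡⟨ cong (λ x → length w₁ + (length w₂ + x)) (length-++ e₁) ⟩
      length w₁ + (length w₂ + (length e₁ + length e₂))
        ≡⟨ cong₂ _+_ (W₁.length-walk lo n (suc t)) (cong₂ _+_ (W₂.length-walk lo n (suc t + t))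
             (cong₂ _+_ (E₁.length-edge false false false t (suc t)) (length-oriented o true true true t c))) ⟩
      n * size + (n * size + (size + size)) ≡⟨ eq n size ⟩
      2 * t * size ∎
      where
      open ≡-Reasoning
      eq : ∀ n s → n * s + (n * s + (s + s)) ≡ 2 * suc n * s
      eq = solve-∀

    open Base {k} {ks} N refl (nonzero ks) 2-torsion [] [] T

    count : 2 * suc (length (nonzero ks)) + 0 + 6 * length T ≡ suc k * order ks
    count = begin
      2 * suc (length (nonzero ks)) + 0 + 6 * length T ≡⟨ cong₂ (λ x y → 2 * x + 0 + 6 * y) (trans length-elements-0 (sym order-size)) length-T ⟩
      2 * (2 * size) + 0 + 6 * (2 * t * size) ≡⟨ eq t size ⟩
      suc k * (2 * size) ≡⟨ cong (suc k *_) order-size ⟩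
      suc k * order ks ∎
      where
      open ≡-Reasoning
      eq : ∀ t s → 2 * (2 * s) + 0 + 6 * (2 * t * s) ≡ suc (t + t + t + suc (t + t + t)) * (2 * s)
      eq = solve-∀

    system⁺ : ∀ {m} → 2 * order ks ≡ 2 ^ m → System (k ∷ ks) m 0
    system⁺ eq = system (λ v → inj₁ (∈-torsion v)) (λ v → inj₁ (∈-torsion v)) (λ h v p q → inj₂ (inner h v p q))
      (trans (cong (2 *_) length-elements-0) eq) refl count

  systemOne : ∀ t {m} → 2 * order ks ≡ 2 ^ m → System (t + t + t + suc (t + t + t) ∷ ks) m 0
  systemOne (suc n) eq = system⁺ n eq
  -- For t = 0 the modulus is 2 and the group consists of zero and involutions, so no pairs are
  -- needed.
  systemOne zero    eq = Base.system {1} {ks} 1 refl (nonzero ks) 2-torsion [] [] []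
    (λ v → inj₁ (∈-torsion v)) (λ v → inj₁ (∈-torsion v)) (λ h v 1≤h h<1 → contradiction 1≤h (<⇒≱ h<1))
    (trans (cong (2 *_) length-elements-0) eq) refl
    (trans (+-identityʳ _) (trans (+-identityʳ _) (cong (2 *_) length-elements-0)))

systemOne₃ : ∀ t → System (t + t + t + suc (t + t + t) ∷ 1 ∷ 1 ∷ []) 3 0
systemOne₃ t = CaseOne.systemOne Dim2.frame Dim2.double refl refl t refl

systemOne₄ : ∀ t → System (t + t + t + suc (t + t + t) ∷ 1 ∷ 1 ∷ 1 ∷ []) 4 0
systemOne₄ t = CaseOne.systemOne Dim3.frame Dim3.double refl refl t refl

-- Tables over named heights.

-- Heights are named by Fin c.  The relation rel α β γ s says α + β = γ (plus) or α + β + γ = modulus (minus).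
data Sign : Set where
  plus minus : Sign

record Relation (c : ℕ) : Set where
  constructor rel
  field
    left right result : Fin c
    sign : Sign

Table : ℕ → List ℕ → Set
Table c ks = List (Relation c × List (Pair ks))

size-of : ∀ {c ks} → Table c ks → ℕ
size-of table = total (map (λ row → length (proj₂ row)) table)

signed : ∀ {ks} → Sign → Elt ks → Elt ks
signed plus  x = x
signed minus x = ⊖ x

module Symbolic {c : ℕ} {ks : List ℕ} (table : Table c ks) (S : List (Fin c × Elt ks)) where

  HitRow : Fin c → Elt ks → Relation c → Pair ks → Set
  HitRow i v (rel α β γ s) (p , q) = (α ≡ i × p ≡ v) ⊎ (β ≡ i × q ≡ v) ⊎ (γ ≡ i × p ⊕ q ≡ signed s v)

  Hit : Fin c → Elt ks → Set
  Hit i v = Any (λ row → Any (HitRow i v (proj₁ row)) (proj₂ row)) table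

  Excluded : Fin c → Elt ks → Set
  Excluded i v = Any (λ s → proj₁ s ≡ i × proj₂ s ≡ v) S

  -- Only names of heights occur, so this is a finite question, decided once for infinitely many
  -- moduli. `At` substitutes the actual heights afterwards.
  Settled : Fin c → Elt ks → Set
  Settled i v = Excluded i v ⊎ Hit i v

  settled? : ∀ i v → Dec (Settled i v)
  settled? i v =
    Any.any? (λ s → (proj₁ s FinP.≟ i) ×-dec (proj₂ s ≟G v)) S
    ⊎-dec Any.any? (λ row → Any.any? (hitRow? (proj₁ row)) (proj₂ row)) table
    where
    hitRow? : ∀ r p → Dec (HitRow i v r p)
    hitRow? (rel α β γ s) (p , q) =
      ((α FinP.≟ i) ×-dec (p ≟G v)) ⊎-dec ((β FinP.≟ i) ×-dec (q ≟G v)) ⊎-dec ((γ FinP.≟ i) ×-dec ((p ⊕ q) ≟G signed s v))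

  module At {k : ℕ} (height : Fin c → ℕ) where

    Holds : Relation c → Set
    Holds (rel α β γ plus)  = height α + height β ≡ height γ
    Holds (rel α β γ minus) = height α + height β + height γ ≡ suc k

    placeRow : Relation c × List (Pair ks) → List (Pair (k ∷ ks))
    placeRow (r , ps) = map (place (height (Relation.left r)) (height (Relation.right r))) ps

    placed : List (Pair (k ∷ ks))
    placed = concatMap placeRow table

    excluded : List (Elt (k ∷ ks))
    excluded = map (λ s → ι (height (proj₁ s)) , proj₂ s) S

    length-placed : length placed ≡ size-of table
    length-placed = lemma table
      where
      lemma : ∀ (t : Table c ks) → length (concatMap placeRow t) ≡ size-of t
      lemma []             = refl
      lemma ((r , ps) ∷ t) = trans (length-++ (placeRow (r , ps))) (cong₂ _+_ (length-map _ ps) (lemma t))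

    hitRow⇒Meets : ∀ r {i v p} → Holds r → HitRow i v r p →
                   let g = ι {k} (height i) , v
                       q = place (height (Relation.left r)) (height (Relation.right r)) p
                   in Meets {k ∷ ks} q g ⊎ Meets q (⊖ g)
    hitRow⇒Meets _ _ (inj₁ (refl , refl)) = inj₁ fst
    hitRow⇒Meets _ _ (inj₂ (inj₁ (refl , refl))) = inj₁ snd
    hitRow⇒Meets (rel α β _ plus)  h (inj₂ (inj₂ (refl , eq))) =
      inj₁ (sum (cong₂ _,_ (trans (sym (ι-+ (height α) (height β))) (cong ι h)) eq))
    hitRow⇒Meets (rel α β γ minus) h (inj₂ (inj₂ (refl , eq))) =
      inj₂ (sum (cong₂ _,_ (ι-opposite (height α) (height β) (height γ) h) eq))

    hit⇒Covers : All (λ row → Holds (proj₁ row)) table → ∀ {i v} → Hit i v → Covers placed (ι (height i) , v)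
    hit⇒Covers holds {i} {v} = lemma table holds
      where
      lemma : ∀ (t : Table c ks) → All (λ row → Holds (proj₁ row)) t →
              Any (λ row → Any (HitRow i v (proj₁ row)) (proj₂ row)) t →
              Covers (concatMap placeRow t) (ι (height i) , v)
      lemma ((r , ps) ∷ t) (h ∷ hs) (here x)  = AnyP.++⁺ˡ (AnyP.map⁺ (Any.map (λ {p} → hitRow⇒Meets r {i} {v} {p} h) x))
      lemma ((r , ps) ∷ t) (h ∷ hs) (there x) = AnyP.++⁺ʳ (placeRow (r , ps)) (lemma t hs x)

    excluded⇒Third : ∀ {i v} → Excluded i v → Third excluded (ι (height i) , v)
    excluded⇒Third x = AnyP.map⁺ (Any.map (λ { (refl , refl) → inj₁ refl }) x)

-- Closing two walks by a table when 3 divides `d`.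

-- The modulus is 6 m.  The first walk runs through [ m , 2 m ), the second through [ 2 m , 3 m ); the
-- table settles what they leave.
module Closure {ks : List ℕ} {fx fy fz : Elt ks → Bool} (F : Frame fx fy fz) (n r : ℕ)
               {c : ℕ} (height : Fin c → ℕ) (table : Table c ks) (S : List (Fin c × Elt ks))
               (torsion : List (Elt ks)) (2-torsion : All (λ (v : Elt ks) → v ⊕ v ≡ 0G ks) torsion) where
  open Frame F using (size)

  m N k : ℕ
  m = suc (n + r)
  N = m + m + m
  k = n + r + m + m + N

  open Symbolic table S
  open At {k} height

  -- With opposite values of `s` the walks leave the half `fy` = true at m and `fy` = false at 2 m.
  -- Where they stop, the first leaves a half `false` and the second a half `true`.
  module W₁ = Walks {k} F false true r
  module W₂ = Walks {k} F true false r

  w₁ w₂ T : List (Pair (k ∷ ks))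
  w₁ = W₁.walk lo n m
  w₂ = W₂.walk lo n (m + m)
  T  = w₁ ++ w₂ ++ placed

  SettledAt : ℕ → Elt ks → Set
  SettledAt h v = Σ (Fin c) λ i → height i ≡ h × Settled i v

  length-T : length T ≡ n * size + (n * size + size-of table)
  length-T = trans (length-++ w₁) (cong₂ _+_ (W₁.length-walk lo n m)
    (trans (length-++ w₂) (cong₂ _+_ (W₂.length-walk lo n (m + m)) length-placed)))

  module _ (holds : All (λ row → Holds (proj₁ row)) table)
           (3-torsion : All (λ (s : Elt (k ∷ ks)) → s ⊕ s ≡ ⊖ s) excluded) where
    open Base {k} {ks} N refl torsion 2-torsion excluded 3-torsion T

    in-w₁ : ∀ h {v} → Covers w₁ (ι h , v) → Resolved h v
    in-w₁ h x = inj₂ (AnyP.++⁺ˡ x)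
    in-w₂ : ∀ h {v} → Covers w₂ (ι h , v) → Resolved h v
    in-w₂ h x = inj₂ (AnyP.++⁺ʳ w₁ (AnyP.++⁺ˡ x))

    settled⇒resolved : ∀ {h v} → SettledAt h v → Resolved h v
    settled⇒resolved (i , refl , inj₁ x) = inj₁ (excluded⇒Third x)
    settled⇒resolved (i , refl , inj₂ x) = inj₂ (AnyP.++⁺ʳ w₁ (AnyP.++⁺ʳ w₂ (hit⇒Covers holds x)))

    -- The heights 0 and N are their own negatives; there `v` may be settled through `⊖ v` at the
    -- same height.
    resolved-⊖ : ∀ h v → ι {k} h ≡ -ₘ ι h → Resolved h (⊖ v) → Resolved h v
    resolved-⊖ h v eq (inj₁ x) = inj₁ (Any.map (λ
      { (inj₁ e) → inj₂ (trans (cong (_, ⊖ v) (sym eq)) e)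
      ; (inj₂ e) → inj₁ (trans (cong₂ _,_ eq (sym (⊖-involutive v))) e) }) x)
    resolved-⊖ h v eq (inj₂ x) = inj₂ (Any.map (λ
      { (inj₁ e) → inj₂ (subst (λ a → Meets _ (a , ⊖ v)) eq e)
      ; (inj₂ e) → inj₁ (subst (Meets _) (cong₂ _,_ (sym eq) (⊖-involutive v)) e) }) x)

    module _ (labels  : ∀ (h : ℕ) (v : Elt ks) → 1 ≤ h → h ≤ r → SettledAt h v)
             (starts₁ : ∀ (v : Elt ks) → fy v ≡ true → SettledAt m v)
             (starts₂ : ∀ (v : Elt ks) → fy v ≡ false → SettledAt (m + m) v)
             (rests₁  : ∀ (h : ℕ) (v : Elt ks) → W₁.Rest lo n m h v → SettledAt h v)
             (rests₂  : ∀ (h : ℕ) (v : Elt ks) → W₂.Rest lo n (m + m) h v → SettledAt h v) where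

      inner : ∀ h v → 1 ≤ h → h < N → Resolved h v
      inner h v 1≤h h<N with h <? m
      ... | yes h<m with h ≤? r
      ...   | yes h≤r = settled⇒resolved (labels h v 1≤h h≤r)
      ...   | no  h≰r with fx v in eq
      ...     | false = in-w₁ h (W₁.walk-label lo n m h v (≰⇒> h≰r) (s≤s⁻¹ h<m) eq)
      ...     | true  = in-w₂ h (W₂.walk-label lo n (m + m) h v (≰⇒> h≰r) (s≤s⁻¹ h<m) eq)
      inner h v 1≤h h<N | no h≮m with h <? m + m
      ... | yes h<2m with W₁.walk-vertex lo n m h v (≮⇒≥ h≮m) (s≤s⁻¹ (subst (h <_) (+-suc m (n + r)) h<2m))
      ...   | inj₁ x = in-w₁ h x
      ...   | inj₂ (inj₁ (refl , e)) = settled⇒resolved (starts₁ v e)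
      ...   | inj₂ (inj₂ x) = settled⇒resolved (rests₁ h v x)
      inner h v 1≤h h<N | no h≮m | no h≮2m
        with W₂.walk-vertex lo n (m + m) h v (≮⇒≥ h≮2m) (s≤s⁻¹ (subst (h <_) (+-suc (m + m) (n + r)) h<N))
      ...   | inj₁ x = in-w₂ h x
      ...   | inj₂ (inj₁ (refl , e)) = settled⇒resolved (starts₂ v e)
      ...   | inj₂ (inj₂ x) = settled⇒resolved (rests₂ h v x)

      closed : (∀ v → v ∈ torsion₀ ⊎ SettledAt 0 v ⊎ SettledAt 0 (⊖ v)) →
               (∀ v → v ∈ torsion₀ ⊎ SettledAt N v ⊎ SettledAt N (⊖ v)) →
               ∀ {d} → 2 * length torsion₀ ≡ 2 ^ d →
               2 * length torsion₀ + 2 * length S + 6 * (n * size + (n * size + size-of table)) ≡ suc k * order ks →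
               System (k ∷ ks) d (length S)
      closed axis middle #inv count = system
        (λ v → map₂ (λ { (inj₁ x) → settled⇒resolved x ; (inj₂ x) → resolved-⊖ 0 v (sym ι-modulus) (settled⇒resolved x) }) (axis v))
        (λ v → map₂ (λ { (inj₁ x) → settled⇒resolved x ; (inj₂ x) → resolved-⊖ N v ιN≡-ιN (settled⇒resolved x) }) (middle v))
        inner #inv (length-map _ S)
        (trans (cong₂ (λ s t → 2 * length torsion₀ + 2 * s + 6 * t) (length-map _ S) length-T) count)
        where
        ιN≡-ιN : ι {k} N ≡ -ₘ ι N
        ιN≡-ιN = cong proj₁ (⊕-inverseʳ-unique {k ∷ []} (ι N , tt) (ι N , tt) (cong (_, tt) ιN+ιN))

-- Where the walks stop, and the closure when each leaves a single height.

rest-end-even : ∀ a → rest-end lo (a * 2) ≡ lo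
rest-end-even zero    = refl
rest-end-even (suc a) = rest-end-even a

rest-end-odd : ∀ a → rest-end lo (suc (a * 2)) ≡ hi
rest-end-odd zero    = refl
rest-end-odd (suc a) = rest-end-odd a

-- Only jumps from the lower end raise the lower bound: a + 1 of the 2 a + 1 jumps.
rest-from-odd : ∀ a b → rest-from lo (suc (a * 2)) b ≡ suc (a + b)
rest-from-odd zero    b = refl
rest-from-odd (suc a) b = trans (rest-from-odd a (suc b)) (cong suc (+-suc a b))

rest-single : ∀ {k ks} {fx fy fz : Elt ks → Bool} (F : Frame fx fy fz) a s o n b h v →
              Walks.Rest {k} F a s 0 o n b h v →
              h ≡ rest-from o n b × colour fy fz (rest-end o n) v ≡ not s
rest-single F a s o n b h v (from , to , side) = h≡ , side (trans h≡ (sym (at-end (rest-end o n) _)))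
  where
  h≡ : h ≡ rest-from o n b
  h≡ = ≤-antisym (subst (h ≤_) (+-identityʳ _) to) from

-- Applied with A = 2 m, a third of the modulus 6 m.
third-of-modulus : ∀ {k ks} A (w : Elt ks) → A + A + A ≡ suc k → w ⊕ w ≡ ⊖ w →
                   _≡_ {A = Elt (k ∷ ks)} ((ι A , w) ⊕ (ι A , w)) (⊖ (ι A , w))
third-of-modulus A w eq e = cong₂ _,_ (ι-opposite A A A eq) e

-- c and c′ are the first heights left over by the two walks, d = c + 1 and d′ = c′ + 1.
pattern ‵0  = 0F
pattern ‵m  = 1F
pattern ‵2m = 2F
pattern ‵3m = 3F
pattern ‵c  = 4F
pattern ‵c′ = 5F
pattern ‵d  = 6F
pattern ‵d′ = 7F
pattern ‵1  = 8F

six : ∀ m → (m + m) + (m + m) + (m + m) ≡ m + m + m + (m + m + m)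
six = solve-∀

module Single (n : ℕ) where
  m : ℕ
  -- The summand 0 makes this agree by definition with the m of `Closure` at r = 0.
  m = suc (n + 0)

  height : Fin 6 → ℕ
  height ‵0  = 0
  height ‵m  = m
  height ‵2m = m + m
  height ‵3m = m + m + m
  height ‵c  = rest-from lo n m
  height ‵c′ = rest-from lo n (m + m)

  height-c′ : height ‵m + height ‵c ≡ height ‵c′
  height-c′ = trans (+-comm m (rest-from lo n m)) (sym (rest-from-+ lo n m m))

  module _ {ks : List ℕ} {fx fy fz : Elt ks → Bool} (F : Frame fx fy fz) (table : Table 6 ks)
           (S : List (Fin 6 × Elt ks))
           (torsion : List (Elt ks)) (2-torsion : All (λ (v : Elt ks) → v ⊕ v ≡ 0G ks) torsion)
           {o : End} (end : rest-end lo n ≡ o) where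
    open Closure F n 0 height table S torsion 2-torsion hiding (m)
    open Symbolic table S
    open At {k} height

    singly-closed :
      All (λ row → Holds (proj₁ row)) table → All (λ s → s ⊕ s ≡ ⊖ s) excluded →
      (∀ v → fy v ≡ true → Settled ‵m v) → (∀ v → fy v ≡ false → Settled ‵2m v) →
      (∀ v → colour fy fz o v ≡ false → SettledAt (height ‵c) v) →
      (∀ v → colour fy fz o v ≡ true → SettledAt (height ‵c′) v) →
      (∀ v → v ∈ 0G ks ∷ torsion ⊎ Settled ‵0 v ⊎ Settled ‵0 (⊖ v)) →
      (∀ v → v ∈ 0G ks ∷ torsion ⊎ Settled ‵3m v ⊎ Settled ‵3m (⊖ v)) →
      ∀ {d} → 2 * suc (length torsion) ≡ 2 ^ d →
      2 * suc (length torsion) + 2 * length S + 6 * (n * Frame.size F + (n * Frame.size F + size-of table)) ≡ suc k * order ks →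
      System (k ∷ ks) d (length S)
    singly-closed holds 3-torsion at-m at-2m at-c at-c′ at-0 at-3m = closed holds 3-torsion
      (λ h v 1≤h h≤0 → contradiction 1≤h (<⇒≱ (s≤s h≤0)))
      (λ v e → ‵m , refl , at-m v e)
      (λ v e → ‵2m , refl , at-2m v e)
      (λ h v x → let h≡ , e = rest-single {k} F false true lo n m h v x in
        subst (λ h → SettledAt h v) (sym h≡) (at-c v (subst (λ o → colour fy fz o v ≡ false) end e)))
      (λ h v x → let h≡ , e = rest-single {k} F true false lo n (m + m) h v x in
        subst (λ h → SettledAt h v) (sym h≡) (at-c′ v (subst (λ o → colour fy fz o v ≡ true) end e)))
      (λ v → map₂ (Sum.map (λ x → ‵0 , refl , x) (λ x → ‵0 , refl , x)) (at-0 v))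
      (λ v → map₂ (Sum.map (λ x → ‵3m , refl , x) (λ x → ‵3m , refl , x)) (at-3m v))

-- Here m = 2 a + 2 is even and the walks stop at 3 m / 2 and 5 m / 2.
height-even : ∀ a → let open Single (suc (a * 2)) in
              height ‵2m + height ‵c + height ‵c′ ≡ m + m + m + (m + m + m)
            × height ‵3m + height ‵c + height ‵c ≡ m + m + m + (m + m + m)
height-even a = trans (cong₂ (λ x y → m + m + x + y) (rest-from-odd a m) (rest-from-odd a (m + m))) (eq₁ a)
              , trans (cong (λ x → m + m + m + x + x) (rest-from-odd a m)) (eq₂ a)
  where
  open Single (suc (a * 2)) using (m)
  eq₁ : ∀ a → suc (suc (a * 2) + 0) + suc (suc (a * 2) + 0) + suc (a + suc (suc (a * 2) + 0))
              + suc (a + (suc (suc (a * 2) + 0) + suc (suc (a * 2) + 0)))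
            ≡ suc (suc (a * 2) + 0) + suc (suc (a * 2) + 0) + suc (suc (a * 2) + 0)
              + (suc (suc (a * 2) + 0) + suc (suc (a * 2) + 0) + suc (suc (a * 2) + 0))
  eq₁ = solve-∀
  eq₂ : ∀ a → suc (suc (a * 2) + 0) + suc (suc (a * 2) + 0) + suc (suc (a * 2) + 0)
              + suc (a + suc (suc (a * 2) + 0)) + suc (a + suc (suc (a * 2) + 0))
            ≡ suc (suc (a * 2) + 0) + suc (suc (a * 2) + 0) + suc (suc (a * 2) + 0)
              + (suc (suc (a * 2) + 0) + suc (suc (a * 2) + 0) + suc (suc (a * 2) + 0))
  eq₂ = solve-∀

-- The case `d` ≡ 3 (mod 6), with V = ℤ₂³.

module CaseTwo where
  ks : List ℕ
  ks = 1 ∷ 1 ∷ 1 ∷ []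

  v : Fin 2 → Fin 2 → Fin 2 → Elt ks
  v a b c = a , b , c , tt

  open Dim3 using (fy; fz; frame; double)

  S : List (Fin 6 × Elt ks)
  S = (‵2m , 0G ks) ∷ []

  -- The half left at 2 m is the chosen order 3 element together with three elements whose V
  -- coordinates sum to zero; these form one triple by 2 m + 2 m + 2 m = 6 m. The halves left at m,
  -- c and c′ are matched by m + c = c′.
  tableOdd : Table 6 ks
  tableOdd =
      (rel ‵2m ‵2m ‵2m minus , (v 0F 0F 1F , v 1F 0F 0F) ∷ [])
    ∷ (rel ‵m ‵c ‵c′ plus , (v 0F 1F 0F , v 1F 0F 0F) ∷ (v 0F 1F 1F , v 0F 0F 1F) ∷ (v 1F 1F 0F , v 1F 0F 1F)
        ∷ (v 1F 1F 1F , v 0F 0F 0F) ∷ [])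
    ∷ []

  -- For even m the walks stop at the upper end, so the halves left at c and c′ belong to `fz`. In
  -- exchange 2 m + c + c′ = 6 m becomes available.
  tableEven : Table 6 ks
  tableEven =
      (rel ‵2m ‵c ‵c′ minus , (v 0F 0F 1F , v 1F 0F 1F) ∷ (v 1F 0F 0F , v 0F 1F 1F) ∷ [])
    ∷ (rel ‵m ‵c ‵c′ plus , (v 0F 1F 0F , v 0F 0F 0F) ∷ (v 1F 1F 1F , v 1F 1F 0F) ∷ [])
    ∷ (rel ‵m ‵m ‵2m plus , (v 0F 1F 1F , v 1F 1F 0F) ∷ [])
    ∷ []

  -- Each of the two tables has 5 pairs, so one identity serves both parities.
  count : ∀ n → 2 * 8 + 2 * 1 + 6 * (n * 4 + (n * 4 + 5)) ≡
          suc (n + 0 + suc (n + 0) + suc (n + 0) + (suc (n + 0) + suc (n + 0) + suc (n + 0))) * 8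
  count = solve-∀

  odd : ∀ a → ∃ λ k → suc k ≡ 6 * suc (a * 2) × System (k ∷ ks) 4 1
  odd a = _ , eq (a * 2) , singly-closed frame tableOdd S (nonzero ks) (All.universal double _) (rest-end-even a)
    (six m ∷ height-c′ ∷ []) (third-of-modulus (m + m) (0G ks) (six m) refl ∷ [])
    (toWitness {a? = ∀Elt? λ v → (fy v Bool.≟ true) →-dec settled? ‵m v} tt)
    (toWitness {a? = ∀Elt? λ v → (fy v Bool.≟ false) →-dec settled? ‵2m v} tt)
    (λ v e → ‵c , refl , toWitness {a? = ∀Elt? λ v → (fy v Bool.≟ false) →-dec settled? ‵c v} tt v e)
    (λ v e → ‵c′ , refl , toWitness {a? = ∀Elt? λ v → (fy v Bool.≟ true) →-dec settled? ‵c′ v} tt v e)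
    (λ v → inj₁ (∈-elements v)) (λ v → inj₁ (∈-elements v)) refl (count (a * 2))
    where
    open Single (a * 2)
    open Symbolic tableOdd S
    eq : ∀ n → suc (n + 0) + suc (n + 0) + suc (n + 0) + (suc (n + 0) + suc (n + 0) + suc (n + 0)) ≡ 6 * suc n
    eq = solve-∀

  even : ∀ a → ∃ λ k → suc k ≡ 6 * suc (suc (a * 2)) × System (k ∷ ks) 4 1
  even a = _ , eq (a * 2) , singly-closed frame tableEven S (nonzero ks) (All.universal double _) (rest-end-odd a)
    (proj₁ (height-even a) ∷ height-c′ ∷ refl ∷ []) (third-of-modulus (m + m) (0G ks) (six m) refl ∷ [])
    (toWitness {a? = ∀Elt? λ v → (fy v Bool.≟ true) →-dec settled? ‵m v} tt)
    (toWitness {a? = ∀Elt? λ v → (fy v Bool.≟ false) →-dec settled? ‵2m v} tt)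
    (λ v e → ‵c , refl , toWitness {a? = ∀Elt? λ v → (fz v Bool.≟ false) →-dec settled? ‵c v} tt v e)
    (λ v e → ‵c′ , refl , toWitness {a? = ∀Elt? λ v → (fz v Bool.≟ true) →-dec settled? ‵c′ v} tt v e)
    (λ v → inj₁ (∈-elements v)) (λ v → inj₁ (∈-elements v)) refl (count (suc (a * 2)))
    where
    open Single (suc (a * 2))
    open Symbolic tableEven S
    eq : ∀ n → suc (suc n + 0) + suc (suc n + 0) + suc (suc n + 0) + (suc (suc n + 0) + suc (suc n + 0) + suc (suc n + 0)) ≡ 6 * suc (suc n)
    eq = solve-∀

-- The case `d` ≡ 9 (mod 18), with V = ℤ₂² × ℤ₃.

module CaseThree where
  ks : List ℕ
  ks = 1 ∷ 1 ∷ 2 ∷ []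

  v : Fin 2 → Fin 2 → Fin 3 → Elt ks
  v a b c = a , b , c , tt

  open Dim2×3 using (fy; fz; frame)
  open DecMembership (_≟G_ {ks}) using (_∈?_)

  torsion : List (Elt ks)
  torsion = v 0F 1F 0F ∷ v 1F 0F 0F ∷ v 1F 1F 0F ∷ []

  2-torsion : All (λ v → v ⊕ v ≡ 0G ks) torsion
  2-torsion = refl ∷ refl ∷ refl ∷ []

  third-0 : ∀ {k} → _≡_ {A = Elt (k ∷ ks)} ((ι 0 , v 0F 0F 1F) ⊕ (ι 0 , v 0F 0F 1F)) (⊖ (ι 0 , v 0F 0F 1F))
  third-0 = cong (_, v 0F 0F 2F) (sym ι-modulus)

  -- Two of the four subgroups of order 3: the factor ℤ₃ of V, and the one in the cyclic factor
  -- ℤ_{6m}.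
  S : List (Fin 6 × Elt ks)
  S = (‵0 , v 0F 0F 1F) ∷ (‵2m , 0G ks) ∷ []

  -- For m = 1 the walks are empty and c, c′ coincide with m, 2 m, so the table settles all of V at
  -- these two heights.
  tableOne : Table 6 ks
  tableOne =
      (rel ‵0 ‵m ‵m plus , (v 0F 1F 1F , v 1F 1F 0F) ∷ (v 1F 0F 1F , v 1F 1F 2F) ∷ (v 1F 1F 1F , v 0F 1F 1F) ∷ [])
    ∷ (rel ‵2m ‵2m ‵2m minus , (v 0F 1F 0F , v 1F 0F 0F) ∷ (v 0F 1F 2F , v 1F 0F 2F) ∷ [])
    ∷ (rel ‵m ‵2m ‵3m plus , (v 0F 0F 0F , v 0F 0F 1F) ∷ (v 0F 0F 1F , v 1F 1F 1F) ∷ (v 1F 0F 0F , v 0F 0F 2F)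
        ∷ (v 1F 1F 1F , v 1F 0F 1F) ∷ [])
    ∷ (rel ‵m ‵m ‵2m plus , (v 0F 0F 2F , v 0F 1F 2F) ∷ [])
    ∷ []

  tableEven : Table 6 ks
  tableEven =
      (rel ‵0 ‵3m ‵3m plus , (v 1F 0F 1F , v 0F 1F 1F) ∷ [])
    ∷ (rel ‵0 ‵c′ ‵c′ plus , (v 1F 1F 1F , v 1F 0F 0F) ∷ [])
    ∷ (rel ‵0 ‵m ‵m plus , (v 0F 1F 1F , v 1F 1F 2F) ∷ [])
    ∷ (rel ‵2m ‵c ‵c′ minus , (v 0F 1F 0F , v 0F 0F 1F) ∷ (v 0F 1F 1F , v 0F 0F 2F) ∷ (v 0F 1F 2F , v 1F 1F 2F) ∷ [])
    ∷ (rel ‵3m ‵c ‵c minus , (v 0F 0F 2F , v 1F 1F 0F) ∷ [])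
    ∷ (rel ‵m ‵2m ‵3m plus , (v 1F 0F 2F , v 0F 0F 2F) ∷ [])
    ∷ (rel ‵m ‵c ‵c′ plus , (v 1F 0F 1F , v 0F 0F 0F) ∷ [])
    ∷ (rel ‵m ‵m ‵2m plus , (v 1F 1F 0F , v 1F 1F 1F) ∷ [])
    ∷ []

  -- With r = 1 no walk uses the label 1. All of V has to be settled at 1, c and c′, but at d and d′
  -- only one half of `fz`.
  tableOdd : Table 9 ks
  tableOdd =
      (rel ‵0 ‵1 ‵1 plus , (v 0F 1F 1F , v 0F 0F 0F) ∷ (v 1F 0F 1F , v 0F 1F 0F) ∷ (v 1F 1F 1F , v 1F 0F 1F) ∷ [])
    ∷ (rel ‵2m ‵2m ‵2m minus , (v 0F 0F 1F , v 0F 1F 0F) ∷ [])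
    ∷ (rel ‵2m ‵c ‵d′ minus , (v 0F 0F 2F , v 0F 1F 1F) ∷ [])
    ∷ (rel ‵2m ‵c′ ‵d minus , (v 0F 1F 1F , v 1F 0F 0F) ∷ [])
    ∷ (rel ‵3m ‵c ‵d minus , (v 0F 0F 2F , v 0F 0F 0F) ∷ (v 0F 1F 1F , v 0F 1F 0F) ∷ (v 1F 0F 1F , v 1F 0F 2F)
        ∷ (v 1F 1F 1F , v 0F 0F 2F) ∷ [])
    ∷ (rel ‵c ‵1 ‵d plus , (v 1F 1F 2F , v 0F 0F 2F) ∷ [])
    ∷ (rel ‵c′ ‵1 ‵d′ plus , (v 0F 0F 0F , v 1F 0F 0F) ∷ (v 0F 1F 2F , v 1F 1F 2F) ∷ (v 1F 0F 1F , v 0F 0F 1F)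
        ∷ (v 1F 0F 2F , v 1F 1F 0F) ∷ (v 1F 1F 2F , v 1F 0F 2F) ∷ [])
    ∷ (rel ‵m ‵c ‵c′ plus , (v 1F 0F 0F , v 1F 1F 1F) ∷ (v 1F 0F 1F , v 0F 1F 2F) ∷ (v 1F 0F 2F , v 1F 0F 0F)
        ∷ (v 1F 1F 0F , v 0F 0F 1F) ∷ (v 1F 1F 1F , v 1F 1F 0F) ∷ (v 1F 1F 2F , v 1F 0F 1F) ∷ [])
    ∷ []

  one : System (5 ∷ ks) 3 2
  one = singly-closed frame tableOne S torsion 2-torsion refl
    (refl ∷ refl ∷ refl ∷ refl ∷ []) (third-0 ∷ third-of-modulus (m + m) (0G ks) (six m) refl ∷ [])
    (λ v _ → at-m v) (λ v _ → at-2m v) (λ v _ → ‵m , refl , at-m v) (λ v _ → ‵2m , refl , at-2m v)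
    -- V now has elements that are not 2-torsion; at 0 and at 3 m it is enough to settle one of `v`
    -- and `⊖ v`.
    (toWitness {a? = ∀Elt? λ v → (v ∈? 0G ks ∷ torsion) ⊎-dec settled? ‵0 v ⊎-dec settled? ‵0 (⊖ v)} tt)
    (toWitness {a? = ∀Elt? λ v → (v ∈? 0G ks ∷ torsion) ⊎-dec settled? ‵3m v ⊎-dec settled? ‵3m (⊖ v)} tt)
    refl refl
    where
    open Single 0
    open Symbolic tableOne S
    at-m : ∀ v → Settled ‵m v
    at-m = toWitness {a? = ∀Elt? λ v → settled? ‵m v} tt
    at-2m : ∀ v → Settled ‵2m v
    at-2m = toWitness {a? = ∀Elt? λ v → settled? ‵2m v} tt

  even : ∀ a → ∃ λ k → suc k ≡ 6 * suc (suc (a * 2)) × System (k ∷ ks) 3 2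
  even a = _ , eq (a * 2) , singly-closed frame tableEven S torsion 2-torsion (rest-end-odd a)
    (refl ∷ refl ∷ refl ∷ proj₁ (height-even a) ∷ proj₂ (height-even a) ∷ sym (+-assoc m m m) ∷ height-c′ ∷ refl ∷ [])
    (third-0 ∷ third-of-modulus (m + m) (0G ks) (six m) refl ∷ [])
    (toWitness {a? = ∀Elt? λ v → (fy v Bool.≟ true) →-dec settled? ‵m v} tt)
    (toWitness {a? = ∀Elt? λ v → (fy v Bool.≟ false) →-dec settled? ‵2m v} tt)
    (λ v e → ‵c , refl , toWitness {a? = ∀Elt? λ v → (fz v Bool.≟ false) →-dec settled? ‵c v} tt v e)
    (λ v e → ‵c′ , refl , toWitness {a? = ∀Elt? λ v → (fz v Bool.≟ true) →-dec settled? ‵c′ v} tt v e)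
    (toWitness {a? = ∀Elt? λ v → (v ∈? 0G ks ∷ torsion) ⊎-dec settled? ‵0 v ⊎-dec settled? ‵0 (⊖ v)} tt)
    (toWitness {a? = ∀Elt? λ v → (v ∈? 0G ks ∷ torsion) ⊎-dec settled? ‵3m v ⊎-dec settled? ‵3m (⊖ v)} tt)
    refl (count (suc (a * 2)))
    where
    open Single (suc (a * 2))
    open Symbolic tableEven S
    eq : ∀ n → suc (suc n + 0) + suc (suc n + 0) + suc (suc n + 0) + (suc (suc n + 0) + suc (suc n + 0) + suc (suc n + 0)) ≡ 6 * suc (suc n)
    eq = solve-∀
    count : ∀ n → 2 * 4 + 2 * 2 + 6 * (n * 6 + (n * 6 + 10)) ≡
            suc (n + 0 + suc (n + 0) + suc (n + 0) + (suc (n + 0) + suc (n + 0) + suc (n + 0))) * 12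
    count = solve-∀

  S₉ : List (Fin 9 × Elt ks)
  S₉ = (‵0 , v 0F 0F 1F) ∷ (‵2m , 0G ks) ∷ []

  -- For odd m ≥ 3 the walks stop one edge early, to make the relation c + d = 3 m available.
  module _ (a : ℕ) where
    private
      n m : ℕ
      n = suc (a * 2)
      m = suc (n + 1)

    height : Fin 9 → ℕ
    height ‵0  = 0
    height ‵m  = m
    height ‵2m = m + m
    height ‵3m = m + m + m
    height ‵c  = rest-from lo n m
    height ‵c′ = rest-from lo n (m + m)
    height ‵d  = suc (height ‵c)
    height ‵d′ = suc (height ‵c′)
    height ‵1  = 1

    open Closure frame n 1 height tableOdd S₉ torsion 2-torsion hiding (m)
    open Symbolic tableOdd S₉
    open At {k} height using (Holds)

    holds : All (λ row → Holds (proj₁ row)) tableOdd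
    holds = refl ∷ six m
      -- Here m = 2 a + 3, c = (3 m - 1) / 2 and c′ = (5 m - 1) / 2, with d and d′ one larger.
      ∷ trans (cong₂ (λ x y → m + m + x + suc y) (rest-from-odd a m) (rest-from-odd a (m + m))) (eq₁ a)
      ∷ trans (cong₂ (λ x y → m + m + y + suc x) (rest-from-odd a m) (rest-from-odd a (m + m))) (eq₂ a)
      ∷ trans (cong (λ x → m + m + m + x + suc x) (rest-from-odd a m)) (eq₃ a)
      ∷ +-comm (height ‵c) 1 ∷ +-comm (height ‵c′) 1
      ∷ trans (+-comm m (height ‵c)) (sym (rest-from-+ lo n m m)) ∷ []
      where
      eq₁ : ∀ a → suc (suc (a * 2) + 1) + suc (suc (a * 2) + 1) + suc (a + suc (suc (a * 2) + 1))
                  + suc (suc (a + (suc (suc (a * 2) + 1) + suc (suc (a * 2) + 1))))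
                ≡ suc (suc (a * 2) + 1) + suc (suc (a * 2) + 1) + suc (suc (a * 2) + 1)
                  + (suc (suc (a * 2) + 1) + suc (suc (a * 2) + 1) + suc (suc (a * 2) + 1))
      eq₁ = solve-∀
      eq₂ : ∀ a → suc (suc (a * 2) + 1) + suc (suc (a * 2) + 1) + suc (a + (suc (suc (a * 2) + 1) + suc (suc (a * 2) + 1)))
                  + suc (suc (a + suc (suc (a * 2) + 1)))
                ≡ suc (suc (a * 2) + 1) + suc (suc (a * 2) + 1) + suc (suc (a * 2) + 1)
                  + (suc (suc (a * 2) + 1) + suc (suc (a * 2) + 1) + suc (suc (a * 2) + 1))
      eq₂ = solve-∀
      eq₃ : ∀ a → suc (suc (a * 2) + 1) + suc (suc (a * 2) + 1) + suc (suc (a * 2) + 1)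
                  + suc (a + suc (suc (a * 2) + 1)) + suc (suc (a + suc (suc (a * 2) + 1)))
                ≡ suc (suc (a * 2) + 1) + suc (suc (a * 2) + 1) + suc (suc (a * 2) + 1)
                  + (suc (suc (a * 2) + 1) + suc (suc (a * 2) + 1) + suc (suc (a * 2) + 1))
      eq₃ = solve-∀

    at-c : ∀ v → Settled ‵c v
    at-c = toWitness {a? = ∀Elt? λ v → settled? ‵c v} tt
    at-c′ : ∀ v → Settled ‵c′ v
    at-c′ = toWitness {a? = ∀Elt? λ v → settled? ‵c′ v} tt
    at-d : ∀ v → fz v ≡ false → Settled ‵d v
    at-d = toWitness {a? = ∀Elt? λ v → (fz v Bool.≟ false) →-dec settled? ‵d v} tt
    at-d′ : ∀ v → fz v ≡ true → Settled ‵d′ v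
    at-d′ = toWitness {a? = ∀Elt? λ v → (fz v Bool.≟ true) →-dec settled? ‵d′ v} tt

    two-left : ∀ {c h : ℕ} → c ≤ h → h ≤ c + 1 → c ≡ h ⊎ suc c ≡ h
    two-left {c} {h} c≤h h≤c+1 with c ≟ h
    ... | yes eq  = inj₁ eq
    ... | no  c≢h = inj₂ (≤-antisym (≤∧≢⇒< c≤h c≢h) (subst (h ≤_) (+-comm c 1) h≤c+1))

    rests₁ : ∀ h v → W₁.Rest lo n m h v → SettledAt h v
    rests₁ h v (from , to , side) with two-left from to
    ... | inj₁ eq = ‵c , eq , at-c v
    ... | inj₂ eq = ‵d , eq , at-d v (subst (λ o → h ≡ at 1 o 0 (height ‵c) → colour fy fz o v ≡ false)
                      (rest-end-odd a) side (trans (sym eq) (+-comm 1 (height ‵c))))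

    rests₂ : ∀ h v → W₂.Rest lo n (m + m) h v → SettledAt h v
    rests₂ h v (from , to , side) with two-left from to
    ... | inj₁ eq = ‵c′ , eq , at-c′ v
    ... | inj₂ eq = ‵d′ , eq , at-d′ v (subst (λ o → h ≡ at 1 o 0 (height ‵c′) → colour fy fz o v ≡ true)
                      (rest-end-odd a) side (trans (sym eq) (+-comm 1 (height ‵c′))))

    odd : ∃ λ k → suc k ≡ 6 * (3 + a * 2) × System (k ∷ ks) 3 2
    odd = k , eq (a * 2) , closed holds (third-0 ∷ third-of-modulus (m + m) (0G ks) (six m) refl ∷ [])
      (λ h v 1≤h h≤1 → ‵1 , ≤-antisym 1≤h h≤1 , toWitness {a? = ∀Elt? λ v → settled? ‵1 v} tt v)
      (λ v e → ‵m , refl , toWitness {a? = ∀Elt? λ v → (fy v Bool.≟ true) →-dec settled? ‵m v} tt v e)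
      (λ v e → ‵2m , refl , toWitness {a? = ∀Elt? λ v → (fy v Bool.≟ false) →-dec settled? ‵2m v} tt v e)
      rests₁ rests₂
      (λ v → map₂ (Sum.map (λ x → ‵0 , refl , x) (λ x → ‵0 , refl , x))
        (toWitness {a? = ∀Elt? λ v → (v ∈? 0G ks ∷ torsion) ⊎-dec settled? ‵0 v ⊎-dec settled? ‵0 (⊖ v)} tt v))
      (λ v → map₂ (Sum.map (λ x → ‵3m , refl , x) (λ x → ‵3m , refl , x))
        (toWitness {a? = ∀Elt? λ v → (v ∈? 0G ks ∷ torsion) ⊎-dec settled? ‵3m v ⊎-dec settled? ‵3m (⊖ v)} tt v))
      refl (count n)
      where
      eq : ∀ n → suc (suc n + 1) + suc (suc n + 1) + suc (suc n + 1)
                 + (suc (suc n + 1) + suc (suc n + 1) + suc (suc n + 1)) ≡ 6 * (3 + n)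
      eq = solve-∀
      count : ∀ n → 2 * 4 + 2 * 2 + 6 * (n * 6 + (n * 6 + 22)) ≡
              suc (n + 1 + suc (n + 1) + suc (n + 1) + (suc (n + 1) + suc (n + 1) + suc (n + 1))) * 12
      count = solve-∀

-- Parities, residues and the assembly of the cases.

parity : ∀ n → (∃ λ a → n ≡ a * 2) ⊎ (∃ λ a → n ≡ suc (a * 2))
parity zero    = inj₁ (0 , refl)
parity (suc n) with parity n
... | inj₁ (a , eq) = inj₂ (a , cong suc eq)
... | inj₂ (a , eq) = inj₁ (suc a , cong suc eq)

systemTwo : ∀ n → ∃ λ k → suc k ≡ 6 * suc n × System (k ∷ 1 ∷ 1 ∷ 1 ∷ []) 4 1
systemTwo n with parity n
... | inj₁ (a , refl) = CaseTwo.odd a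
... | inj₂ (a , refl) = CaseTwo.even a

systemThree : ∀ n → ∃ λ k → suc k ≡ 6 * suc n × System (k ∷ 1 ∷ 1 ∷ 2 ∷ []) 3 2
systemThree n with parity n
-- The general odd construction starts at m = 3, so m = 1 has a table of its own.
... | inj₁ (zero , refl)  = 5 , refl , CaseThree.one
... | inj₁ (suc a , refl) = CaseThree.odd a
... | inj₂ (a , refl)     = CaseThree.even a

-- D will be 2 ^ ℓ * d: the factor 2 ^ ℓ is absorbed by the cyclic factor of even order, where it
-- creates no new involutions.
Realised : ℕ → ℕ → ℕ → Set
Realised D m e = ∃ λ ks → order ks ≡ 2 ^ m * D × System ks m e

inflate-realised : ∀ a {D m e} → Realised D m e → Realised D (a * 2 + m) e
inflate-realised zero    r = r
inflate-realised (suc a) {D} {m} r with inflate-realised a r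
... | ks , eq , sys = 1 ∷ 1 ∷ ks , trans (cong (λ x → 2 * (2 * x)) eq) (eq′ (2 ^ (a * 2 + m)) D) , Inflate.inflate sys
  where
  eq′ : ∀ p D → 2 * (2 * (p * D)) ≡ 2 * (2 * p) * D
  eq′ = solve-∀

parity-clash : ∀ a b → (a * 2) % 2 ≡ suc (b * 2) % 2 → ∀ {A : Set} → A
parity-clash a b eq with trans (sym ([m+kn]%n≡m%n 0 a 2)) (trans eq ([m+kn]%n≡m%n 1 b 2))
... | ()

even-parity : ∀ n → n % 2 ≡ 0 → ∃ λ a → n ≡ a * 2
even-parity n eq with parity n
... | inj₁ x          = x
... | inj₂ (a , refl) = parity-clash 0 a (sym eq)

odd-parity : ∀ n → n % 2 ≡ 1 → ∃ λ a → n ≡ suc (a * 2)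
odd-parity n eq with parity n
... | inj₁ (a , refl) = parity-clash a 0 eq
... | inj₂ x          = x

four-power : ∀ a → ∃ λ x → 2 ^ (a * 2) ≡ 1 + 3 * x
four-power zero    = 0 , refl
four-power (suc a) with four-power a
... | x , eq = 1 + 4 * x , trans (cong (λ p → 2 * (2 * p)) eq) (eq′ x)
  where
  eq′ : ∀ x → 2 * (2 * (1 + 3 * x)) ≡ 1 + 3 * (1 + 4 * x)
  eq′ = solve-∀

-- Modulo 3 both 2 ^ ℓ and d are (-1) ^ ℓ, so their product is 1. It becomes N = 3 t + 1.
one-mod-three : ∀ d ℓ → (ℓ % 2 ≡ 0 × d % 6 ≡ 1) ⊎ (ℓ % 2 ≡ 1 × d % 6 ≡ 5) → ∃ λ t → 2 ^ ℓ * d ≡ suc (t + t + t)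
one-mod-three d ℓ (inj₁ (ℓ-even , d≡1)) with even-parity ℓ ℓ-even
... | a , refl with four-power a
...   | x , eq = x + d / 6 * 2 + x * (d / 6) * 6 , trans (cong₂ _*_ eq (trans (m≡m%n+[m/n]*n d 6) (cong (_+ d / 6 * 6) d≡1))) (eq′ x (d / 6))
  where
  eq′ : ∀ x q → (1 + 3 * x) * (1 + q * 6) ≡ suc ((x + q * 2 + x * q * 6) + (x + q * 2 + x * q * 6) + (x + q * 2 + x * q * 6))
  eq′ = solve-∀
one-mod-three d ℓ (inj₂ (ℓ-odd , d≡5)) with odd-parity ℓ ℓ-odd
... | a , refl with four-power a
...   | x , eq = 3 + d / 6 * 4 + x * 10 + x * (d / 6) * 12 , trans (cong₂ _*_ (cong (2 *_) eq) (trans (m≡m%n+[m/n]*n d 6) (cong (_+ d / 6 * 6) d≡5))) (eq′ x (d / 6))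
  where
  eq′ : ∀ x q → 2 * (1 + 3 * x) * (5 + q * 6) ≡ suc ((3 + q * 4 + x * 10 + x * q * 12) + (3 + q * 4 + x * 10 + x * q * 12) + (3 + q * 4 + x * 10 + x * q * 12))
  eq′ = solve-∀

-- The residue c modulo 2 c makes d an odd multiple c (1 + 2 q); then n + 1 is the positive number 2
-- ^ ℓ (1 + 2 q).
odd-multiple : ∀ d ℓ c .{{_ : NonZero (c * 2)}} → d % (c * 2) ≡ c → ∃ λ n → 2 ^ ℓ * d ≡ c * suc n
odd-multiple d ℓ c eq = _ , trans (cong (2 ^ ℓ *_) (trans (m≡m%n+[m/n]*n d (c * 2)) (cong (_+ q * (c * 2)) eq)))
  (trans (eq′ (2 ^ ℓ) c q) (cong (c *_) (sym (suc-pred (2 ^ ℓ * suc (q * 2)) {{m*n≢0 (2 ^ ℓ) _ {{m^n≢0 2 ℓ}}}}))))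
  where
  q = d / (c * 2)
  eq′ : ∀ p c q → p * (c + q * (c * 2)) ≡ c * (p * suc (q * 2))
  eq′ = solve-∀

realised-one : ∀ t i → Realised (suc (t + t + t)) (3 + i) 0
realised-one t i with parity i
... | inj₁ (a , refl) = subst (λ m → Realised (suc (t + t + t)) m 0) (+-comm (a * 2) 3) (inflate-realised a (_ , eq t , systemOne₃ t))
  where
  eq : ∀ t → suc (t + t + t + suc (t + t + t)) * 4 ≡ 8 * suc (t + t + t)
  eq = solve-∀
... | inj₂ (a , refl) = subst (λ m → Realised (suc (t + t + t)) m 0) (+-comm (a * 2) 4) (inflate-realised a (_ , eq t , systemOne₄ t))
  where
  eq : ∀ t → suc (t + t + t + suc (t + t + t)) * 8 ≡ 16 * suc (t + t + t)
  eq = solve-∀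

realised-two : ∀ n i → (3 + i) % 2 ≡ 0 → Realised (3 * suc n) (3 + i) 1
realised-two n i eq with parity i
... | inj₁ (a , refl) = parity-clash 0 (suc a) (sym eq)
... | inj₂ (a , refl) with systemTwo n
...   | k , k≡ , sys = subst (λ m → Realised (3 * suc n) m 1) (+-comm (a * 2) 4)
  (inflate-realised a (_ , trans (cong (_* 8) k≡) (eq′ n) , sys))
  where
  eq′ : ∀ n → 6 * suc n * 8 ≡ 16 * (3 * suc n)
  eq′ = solve-∀

realised-three : ∀ n i → (3 + i) % 2 ≡ 1 → Realised (9 * suc n) (3 + i) 2
realised-three n i eq with parity i
... | inj₂ (a , refl) = parity-clash (suc (suc a)) 0 eq
... | inj₁ (a , refl) with systemThree n
...   | k , k≡ , sys = subst (λ m → Realised (9 * suc n) m 2) (+-comm (a * 2) 3)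
  (inflate-realised a (_ , trans (cong (_* 12) k≡) (eq′ n) , sys))
  where
  eq′ : ∀ n → 6 * suc n * 12 ≡ 8 * (9 * suc n)
  eq′ = solve-∀

conclude : ∀ d ℓ {m e D} → 1 ≤ m → e ≤ 2 → 2 ^ ℓ * d ≡ D → Realised D m e →
           Σ (List ℕ) λ ks → order ks ≡ 2 ^ (ℓ + m) * d × HasExactlyInvolutions ks (2 ^ m ∸ 1)
                            × Σ ℕ λ e → e ≤ 2 × HasDF23 ks (2 ^ m ∸ 1) e
conclude d ℓ {m} 1≤m e≤2 refl (ks , eq , sys) =
  ks , trans eq (trans (eq′ (2 ^ m) (2 ^ ℓ) d) (cong (_* d) (sym (^-distribˡ-+-* 2 ℓ m))))
     , FromSystem.hasExactlyInvolutions sys 1≤m , _ , e≤2 , FromSystem.hasDF23 sys 1≤m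
  where
  eq′ : ∀ p q d → p * (q * d) ≡ q * p * d
  eq′ = solve-∀

theorem3p1 : (d ℓ m : ℕ) → 1 ≤ d → d % 2 ≡ 1 → 3 ≤ m → Hyp31 d ℓ m →
    Σ (List ℕ) λ ks →
    order ks ≡ 2 ^ (ℓ + m) * d
    × HasExactlyInvolutions ks (2 ^ m ∸ 1)
    × Σ ℕ λ e → e ≤ 2 × HasDF23 ks (2 ^ m ∸ 1) e
theorem3p1 d ℓ (suc (suc (suc i))) _ _ (s≤s (s≤s (s≤s z≤n))) = λ
  { (inj₁ h) → first (inj₁ h)
  ; (inj₂ (inj₁ h)) → first (inj₂ h)
  ; (inj₂ (inj₂ (inj₁ (m-even , d≡3)))) →
      let n , eq = odd-multiple d ℓ 3 d≡3 in conclude d ℓ (s≤s z≤n) (s≤s z≤n) eq (realised-two n i m-even)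
  ; (inj₂ (inj₂ (inj₂ (m-odd , d≡9)))) →
      let n , eq = odd-multiple d ℓ 9 d≡9 in conclude d ℓ (s≤s z≤n) ≤-refl eq (realised-three n i m-odd) }
  where
  first : _ → _
  first h = let t , eq = one-mod-three d ℓ h in conclude d ℓ (s≤s z≤n) z≤n eq (realised-one t i)
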